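{- There exists a real number $d_0'>0$ such that for all $d\geq d_0'$ the following holds. Let $G$ be an $n$-vertex $(1\pm 10^{ -10})d$-regular graph and let $T$ be an $n$-vertex tree. Then $$N(T;G)\leq e^{ -n/1000}d^n.$$
   Context: For constants $d,\delta>0$, a graph is called $(1\pm\delta)d$-regular if every vertex degree lies in $[(1-\delta)d,(1+\delta)d]$. For an $n$-vertex graph $G$ and an $n$-vertex tree $T$, $N(T;G)$ denotes the number of labeled copies of $T$ in $G$, i.e. the number of spanning subgraphs of $G$ (as edge sets) that are isomorphic to $T$.
   Formalization: The degree parameter d and the threshold d_0' are taken rational; the case of real d follows by replacing d with the rational max(d_0', Δ(G)/(1+10^{ -10})) ≤ d, Δ(G) being the maximum degree. The inequality with e is stated through all partial sums of its series. -}

module Defs where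

open import Data.Bool using (Bool; true; false; if_then_else_)
open import Data.Nat as ℕ using (ℕ; zero; suc; _!)
open import Data.Nat.Properties using (_!≢0)
open import Data.Fin using (Fin)
open import Data.Fin.Permutation using (Permutation′; _⟨$⟩ʳ_)
open import Data.List using (List; []; _∷_; map; allFin; length)
open import Data.Nat.ListAction using (sum)
open import Data.List.Relation.Unary.AllPairs using (AllPairs)
open import Data.List.Relation.Unary.Unique.Propositional using (Unique)
open import Data.Integer using (+_)
open import Data.Rational using (ℚ; 0ℚ; 1ℚ; _+_; _*_; _-_; _/_; _≤_)
open import Data.Product using (Σ; ∃; ∃-syntax; _×_)
open import Relation.Binary.PropositionalEquality using (_≡_; _≢_)
open import Relation.Nullary using (¬_)

record Graph (n : ℕ) : Set where
  field
    adj   : Fin n → Fin n → Bool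
    sym   : ∀ i j → adj i j ≡ adj j i
    irrefl : ∀ i → adj i i ≡ false
open Graph public

degree : ∀ {n} → Graph n → Fin n → ℕ
degree {n} G i = sum (map (λ j → if adj G i j then 1 else 0) (allFin n))

ℕ→ℚ : ℕ → ℚ
ℕ→ℚ m = (+ m) / 1

_^ℚ_ : ℚ → ℕ → ℚ
q ^ℚ zero  = 1ℚ
q ^ℚ suc k = q * (q ^ℚ k)

δ : ℚ
δ = (+ 1) / (10 ℕ.^ 10)

AlmostRegular : ∀ {n} → ℚ → ℚ → Graph n → Set
AlmostRegular {n} δ' d G =
  ∀ (i : Fin n) → ((1ℚ - δ') * d ≤ ℕ→ℚ (degree G i))
                × (ℕ→ℚ (degree G i) ≤ (1ℚ + δ') * d)

data Walk {n} (G : Graph n) : Fin n → Fin n → Set where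
  here : ∀ {u} → Walk G u u
  step : ∀ {u v w} → adj G u v ≡ true → Walk G v w → Walk G u w

Connected : ∀ {n} → Graph n → Set
Connected {n} G = ∀ (u v : Fin n) → Walk G u v

data IsPath {n} (G : Graph n) : Fin n → List (Fin n) → Fin n → Set where
  end  : ∀ {u} → IsPath G u [] u
  cons : ∀ {u v w vs} → adj G u v ≡ true → IsPath G v vs w → IsPath G u (v ∷ vs) w

HasCycle : ∀ {n} → Graph n → Set
HasCycle {n} G =
  Σ (Fin n) λ v₀ → Σ (Fin n) λ v₁ → Σ (List (Fin n)) λ vs → Σ (Fin n) λ vₖ →
    Unique (v₀ ∷ v₁ ∷ vs ++' vₖ) × adj G v₀ v₁ ≡ true × IsPath G v₁ (vs ++' vₖ) vₖ
    × adj G vₖ v₀ ≡ true × (1 ℕ.≤ length (vs ++' vₖ))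
  where
  _++'_ : List (Fin n) → Fin n → List (Fin n)
  [] ++' x = x ∷ []
  (y ∷ ys) ++' x = y ∷ (ys ++' x)

IsTree : ∀ {n} → Graph n → Set
IsTree G = Connected G × ¬ HasCycle G

_⊆G_ : ∀ {n} → Graph n → Graph n → Set
H ⊆G G = ∀ i j → adj H i j ≡ true → adj G i j ≡ true

_≅_ : ∀ {n} → Graph n → Graph n → Set
_≅_ {n} H T = Σ (Permutation′ n) λ σ → ∀ i j → adj T i j ≡ adj H (σ ⟨$⟩ʳ i) (σ ⟨$⟩ʳ j)

IsCopy : ∀ {n} → Graph n → Graph n → Graph n → Set
IsCopy T G H = (H ⊆G G) × (H ≅ T)

DifferentEdgeSets : ∀ {n} → Graph n → Graph n → Set
DifferentEdgeSets {n} H H' = Σ (Fin n) λ i → Σ (Fin n) λ j → adj H i j ≢ adj H' i j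

data AllCopies {n} (T G : Graph n) : List (Graph n) → Set where
  []  : AllCopies T G []
  _∷_ : ∀ {H Hs} → IsCopy T G H → AllCopies T G Hs → AllCopies T G (H ∷ Hs)

NumCopiesAtMost : ∀ {n} → Graph n → Graph n → (ℕ → Set) → Set
NumCopiesAtMost {n} T G Bound =
  ∀ (Hs : List (Graph n)) → AllCopies T G Hs → AllPairs DifferentEdgeSets Hs → Bound (length Hs)

ePartial : ℕ → ℚ
ePartial zero = 0ℚ
ePartial (suc k) = ePartial k + ((+ 1) / (k !)) {{k !≢0}}

-- "N ≤ e^{-n/1000} dⁿ"  ⇔  N^1000 · eⁿ ≤ d^{1000 n}  ⇔  ∀ k, N^1000 · eₖⁿ ≤ d^{1000 n}
-- (since eₖ ↑ e and all quantities are nonnegative)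
BelowBound : ℕ → ℚ → ℕ → Set
BelowBound n d N = ∀ (k : ℕ) → (ℕ→ℚ N ^ℚ 1000) * (ePartial k ^ℚ n) ≤ d ^ℚ (1000 ℕ.* n)

{-# OPTIONS --safe #-}
-- Root T and let π send each vertex to its parent (and the root to one of its children); let L be
-- the number of vertices outside the image of π, and D the maximal degree of G.  Minc's bound
-- per(A) ≤ ∏ (rᵢ + 1) / 2 saves a constant factor per row over the trivial bound ∏ rᵢ; it is
-- used in a form that also allows for a few columns that are hit by no row.
-- If L ≥ n / 100, embed the other vertices greedily, parents first; placing the L leaves is then
-- a matching problem, which saves a factor 3/5 per leaf.
-- If L ≤ n / 100, a copy H of T is determined by its parent function x ↦ f x, as T has no other
-- edges; f is nearly a bijection, since its image misses only L vertices, so the functions f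
-- are nearly matchings of the adjacency matrix of G.
module Submission where

open import Defs renaming (sym to adj-sym)
open import Data.Bool using (Bool; true; false; if_then_else_)
open import Data.Bool.Properties using (T?; T-≡)
open import Data.Nat using (ℕ; zero; suc; z≤n; s≤s; NonZero)
open import Data.Nat.Tactic.RingSolver using (solve-∀)
open import Data.Nat.ListAction using (sum)
open import Data.Fin using (Fin; zero; suc; _≟_)
open import Data.Fin.Properties using (any?)
open import Data.Fin.Permutation using (_⟨$⟩ʳ_; _⟨$⟩ˡ_; inverseˡ; inverseʳ)
open import Data.List using (List; []; _∷_; map; length; _++_; concatMap; filter; filterᵇ; allFin)
open import Data.List.Properties using (length-++; length-map; length-removeAt′; length-tabulate; filter-all; filter-none)
open import Data.List.Membership.Propositional using (_∈_; _∉_)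
open import Data.List.Membership.Propositional.Properties
  using (∈-map⁺; ∈-map⁻; ∈-concatMap⁺; ∈-filter⁺; ∈-filter⁻; ∈-lookup; ∈-allFin)
open import Data.List.Membership.DecPropositional using (_∈?_)
open import Data.List.Relation.Unary.Any as Any using (Any; here; there; _─_; index)
open import Data.List.Relation.Unary.Any.Properties
  using (++⁺ˡ; ++⁺ʳ; lookup-result; concatMap⁺) renaming (map⁺ to Any-map⁺)
open import Data.List.Relation.Unary.All as All using (All; []; _∷_)
import Data.List.Relation.Unary.All.Properties as All
open import Data.List.Relation.Unary.AllPairs using (AllPairs; []; _∷_)
import Data.List.Relation.Unary.AllPairs.Properties as AllPairs
open import Data.List.Relation.Unary.Unique.Propositional using (Unique)
open import Data.List.Relation.Unary.Unique.Propositional.Properties using (allFin⁺; filter⁺)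
open import Data.List.Relation.Binary.Permutation.Propositional using (_↭_; ↭-refl; ↭-sym; ↭-trans; prep; swap)
open import Data.List.Relation.Binary.Permutation.Propositional.Properties using (∈-resp-↭; Any-resp-↭)
open import Data.Product using (Σ; ∃-syntax; Σ-syntax; _×_; _,_; proj₁; proj₂)
open import Data.Sum using (_⊎_; inj₁; inj₂)
open import Data.Unit using (⊤; tt)
open import Function using (_∘_; Equivalence)
open import Relation.Binary.PropositionalEquality
open import Relation.Nullary using (¬_; Dec; yes; no; contradiction; does)
open import Relation.Nullary.Decidable using (¬?; decidable-stable; toWitness)
open import Relation.Unary using (Decidable)

-- With few leaves the obstacle is that the parent function is not injective: L columns are missed,
-- and L rows are left over once every hit column has designated a row. A weighting replaces the sum
-- over missed sets: a skipped column costs a factor y = 100, and in return every column loses only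
-- 101/100. A leftover row would have weight 1 in Minc's product although it may take up to D
-- values; adding t, about 2D/y, to all row sums lets one factor y pay for these values, at a loss
-- of at most 102/100 per row. The constant 3/5 leaves room above 101 * 102 / (2 * 100 * 100). The
-- total cost 100^(2L) is at most 1.1^n when L ≤ n/100, well below the gain (5/3)^n. Sending the
-- root to a child makes it an ordinary row, adjacent to its value. Codes may repeat, since only
-- upper bounds are sought.

module Counting where
  open import Data.Nat hiding (_≟_)
  open import Data.Nat.Properties hiding (_≟_)
  open import Data.Nat.DivMod using (m≡m%n+[m/n]*n; m%n<n; m/n*n≤m; m*n/n≡m; /-monoˡ-≤)
  open import Data.Nat using () renaming (_≟_ to _≟ℕ_)

  -- Pigeonhole principle and lengths of lists

  module _ {X E : Set} {_#_ : X → X → Set} {R : X → E → Set}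
           (separated : ∀ {x y e} → R x e → R y e → ¬ x # y) where

    private
      Any-─ : ∀ {x y es} → x # y → (p : Any (R x) es) → Any (R y) es → Any (R y) (es ─ p)
      Any-─ x#y (here r)  (here s)  = contradiction x#y (separated r s)
      Any-─ x#y (here r)  (there q) = q
      Any-─ x#y (there p) (here s)  = here s
      Any-─ x#y (there p) (there q) = there (Any-─ x#y p q)

    -- Elements related to a common entry of `es` are never separated, so deleting the entry used by
    -- the first element leaves every other element an entry of its own.
    pigeonhole : ∀ {xs es} → AllPairs _#_ xs → All (λ x → Any (R x) es) xs → length xs ≤ length es
    pigeonhole [] [] = z≤n
    pigeonhole {_ ∷ xs} {es} (x#xs ∷ pairs) (p ∷ ps) =
      subst (suc (length xs) ≤_) (sym (length-removeAt′ es (index p)))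
        (s≤s (pigeonhole pairs (All.zipWith (λ (x#y , q) → Any-─ x#y p q) (x#xs , ps))))

  length-bijection : {A B : Set} (f : A → B) (g : B → A) → (∀ a → g (f a) ≡ a) → (∀ b → f (g b) ≡ b) →
    ∀ {xs ys} → Unique xs → Unique ys → (∀ {a} → a ∈ xs → f a ∈ ys) → (∀ {b} → b ∈ ys → g b ∈ xs) →
    length xs ≡ length ys
  length-bijection f g gf fg ux uy to from = ≤-antisym
    (pigeonhole {R = λ a b → f a ≡ b} (λ { refl q a≢b → a≢b (trans (sym (gf _)) (trans (cong g (sym q)) (gf _))) })
      ux (All.tabulate to))
    (pigeonhole {R = λ b a → g b ≡ a} (λ { refl q a≢b → a≢b (trans (sym (fg _)) (trans (cong f (sym q)) (fg _))) })
      uy (All.tabulate from))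

  ⟦_⟧ : Bool → ℕ
  ⟦ b ⟧ = if b then 1 else 0

  hits : {B : Set} → (B → Bool) → List B → ℕ
  hits p xs = sum (map (λ x → if p x then 1 else 0) xs)

  length-filterᵇ : {B : Set} (p : B → Bool) → ∀ xs → length (filterᵇ p xs) ≡ hits p xs
  length-filterᵇ p [] = refl
  length-filterᵇ p (x ∷ xs) with p x
  ... | true  = cong suc (length-filterᵇ p xs)
  ... | false = length-filterᵇ p xs

  hits-filter : {B : Set} {Q : B → Set} (p : B → Bool) (Q? : Decidable Q) → ∀ xs → hits p (filter Q? xs) ≤ hits p xs
  hits-filter p Q? [] = z≤n
  hits-filter p Q? (x ∷ xs) with does (Q? x)
  ... | true  = +-monoʳ-≤ ⟦ p x ⟧ (hits-filter p Q? xs)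
  ... | false = ≤-trans (hits-filter p Q? xs) (m≤n+m _ ⟦ p x ⟧)

  hits≤length : {B : Set} (p : B → Bool) → ∀ xs → hits p xs ≤ length xs
  hits≤length p [] = z≤n
  hits≤length p (x ∷ xs) with p x
  ... | true  = s≤s (hits≤length p xs)
  ... | false = ≤-trans (hits≤length p xs) (n≤1+n _)

  length-concatMap-≤ : {A B : Set} (f : A → List B) (w v : ℕ) → (∀ a → length (f a) * w ≤ v) →
    ∀ xs → length (concatMap f xs) * w ≤ length xs * v
  length-concatMap-≤ f w v bound [] = z≤n
  length-concatMap-≤ f w v bound (x ∷ xs) = begin
    length (f x ++ concatMap f xs) * w               ≡⟨ cong (_* w) (length-++ (f x)) ⟩
    (length (f x) + length (concatMap f xs)) * w     ≡⟨ *-distribʳ-+ w (length (f x)) _ ⟩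
    length (f x) * w + length (concatMap f xs) * w   ≤⟨ +-mono-≤ (bound x) (length-concatMap-≤ f w v bound xs) ⟩
    v + length xs * v                                ∎
    where open ≤-Reasoning

  -- Permanent bound: a single column

  -- Minc's inequality for one column e of a 0/1 matrix: s a is the weight of row a without that column.
  module Column {A : Set} (e : A → Bool) (s : A → ℕ) where

    without with⁺ with⁻ deleted : List A → ℕ
    without []       = 1
    without (a ∷ as) = suc (s a) * without as
    with⁺ []       = 1
    with⁺ (a ∷ as) = suc (⟦ e a ⟧ + s a) * with⁺ as
    with⁻ []       = 1
    with⁻ (a ∷ as) = (if e a then s a else suc (s a)) * with⁻ as
    deleted []       = 0
    deleted (a ∷ as) = ⟦ e a ⟧ * without as + suc (s a) * deleted as

    with⁻≤with⁺ : ∀ as → with⁻ as ≤ with⁺ as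
    with⁻≤with⁺ [] = ≤-refl
    with⁻≤with⁺ (a ∷ as) with e a
    ... | true  = *-mono-≤ (≤-trans (n≤1+n (s a)) (n≤1+n _)) (with⁻≤with⁺ as)
    ... | false = *-monoʳ-≤ (suc (s a)) (with⁻≤with⁺ as)

    without≤with⁺ : ∀ as → without as ≤ with⁺ as
    without≤with⁺ [] = ≤-refl
    without≤with⁺ (a ∷ as) = *-mono-≤ (s≤s (m≤n+m (s a) ⟦ e a ⟧)) (without≤with⁺ as)

    -- Write `x` for `suc (s a)`. In the products of `x + e` and `x - e` the terms of odd degree in
    -- `e` cancel; those of even degree count twice, and the product of the `x` is one of them.
    2*without≤ : ∀ as → 2 * without as ≤ with⁻ as + with⁺ as
    2*without≤ [] = ≤-refl
    2*without≤ (a ∷ as) with e a | 2*without≤ as | with⁻≤with⁺ as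
    ... | true  | ih | y≤z = begin
          2 * (suc (s a) * without as)                         ≡⟨ eq₁ (s a) (without as) ⟩
          suc (s a) * (2 * without as)                         ≤⟨ *-monoʳ-≤ (suc (s a)) ih ⟩
          suc (s a) * (with⁻ as + with⁺ as)                    ≡⟨ eq₂ (s a) (with⁻ as) (with⁺ as) ⟩
          with⁻ as + (s a * with⁻ as + suc (s a) * with⁺ as)   ≤⟨ +-monoˡ-≤ _ y≤z ⟩
          with⁺ as + (s a * with⁻ as + suc (s a) * with⁺ as)   ≡⟨ eq₃ (s a) (with⁻ as) (with⁺ as) ⟩
          s a * with⁻ as + suc (suc (s a)) * with⁺ as          ∎
      where
      open ≤-Reasoning
      eq₁ : ∀ s p → 2 * (suc s * p) ≡ suc s * (2 * p)
      eq₁ = solve-∀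
      eq₂ : ∀ s y z → suc s * (y + z) ≡ y + (s * y + suc s * z)
      eq₂ = solve-∀
      eq₃ : ∀ s y z → z + (s * y + suc s * z) ≡ s * y + suc (suc s) * z
      eq₃ = solve-∀
    ... | false | ih | y≤z = begin
          2 * (suc (s a) * without as)                         ≡⟨ eq₁ (s a) (without as) ⟩
          suc (s a) * (2 * without as)                         ≤⟨ *-monoʳ-≤ (suc (s a)) ih ⟩
          suc (s a) * (with⁻ as + with⁺ as)                    ≡⟨ *-distribˡ-+ (suc (s a)) (with⁻ as) _ ⟩
          suc (s a) * with⁻ as + suc (s a) * with⁺ as          ∎
      where
      open ≤-Reasoning
      eq₁ : ∀ s p → 2 * (suc s * p) ≡ suc s * (2 * p)
      eq₁ = solve-∀

    -- Dually, the difference of the two products is twice the terms of odd degree in `e`, and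
    -- `deleted` collects those of degree one. The 2 answers to Minc's factor 1/2 of the row that an
    -- expansion along the column removes.
    2*deleted+with⁻≤with⁺ : ∀ as → 2 * deleted as + with⁻ as ≤ with⁺ as
    2*deleted+with⁻≤with⁺ [] = ≤-refl
    2*deleted+with⁻≤with⁺ (a ∷ as) with e a | 2*deleted+with⁻≤with⁺ as
    ... | true  | ih = +-cancelˡ-≤ (with⁻ as) _ _ (begin
          with⁻ as + (2 * (1 * without as + suc (s a) * deleted as) + s a * with⁻ as)
            ≡⟨ eq₁ (s a) (without as) (deleted as) (with⁻ as) ⟩
          2 * without as + suc (s a) * (2 * deleted as + with⁻ as)
            ≤⟨ +-mono-≤ (2*without≤ as) (*-monoʳ-≤ (suc (s a)) ih) ⟩
          with⁻ as + with⁺ as + suc (s a) * with⁺ as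
            ≡⟨ +-assoc (with⁻ as) _ _ ⟩
          with⁻ as + suc (suc (s a)) * with⁺ as ∎)
      where
      open ≤-Reasoning
      eq₁ : ∀ s p x y → y + (2 * (1 * p + suc s * x) + s * y) ≡ 2 * p + suc s * (2 * x + y)
      eq₁ = solve-∀
    ... | false | ih = begin
          2 * (suc (s a) * deleted as) + suc (s a) * with⁻ as  ≡⟨ eq₁ (s a) (deleted as) (with⁻ as) ⟩
          suc (s a) * (2 * deleted as + with⁻ as)              ≤⟨ *-monoʳ-≤ (suc (s a)) ih ⟩
          suc (s a) * with⁺ as                                 ∎
      where
      open ≤-Reasoning
      eq₁ : ∀ s x y → 2 * (suc s * x) + suc s * y ≡ suc s * (2 * x + y)
      eq₁ = solve-∀

  -- Enumeration and count of near-matchings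

  pickAll : {A X : Set} → (A → List A → List X) → List A → List X
  pickAll F []       = []
  pickAll F (a ∷ as) = F a as ++ pickAll (λ b bs → F b (a ∷ bs)) as

  Any-pickAll : {A X : Set} (F : A → List A → List X) {R : X → Set} {Q : A → Set} {as : List A} (p : Any Q as) →
    Any R (F (Any.lookup p) (as ─ p)) → Any R (pickAll F as)
  Any-pickAll F (here _)  r = ++⁺ˡ r
  Any-pickAll F {as = a ∷ as} (there p) r = ++⁺ʳ (F a as) (Any-pickAll (λ b bs → F b (a ∷ bs)) p r)

  ↭-lookup-─ : {A : Set} {Q : A → Set} {as : List A} (p : Any Q as) → Any.lookup p ∷ (as ─ p) ↭ as
  ↭-lookup-─ (here _) = ↭-refl
  ↭-lookup-─ {as = a ∷ as} (there p) = ↭-trans (swap _ a ↭-refl) (prep a (↭-lookup-─ p))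

  module _ {A B : Set} where

    -- A code lists the rows in the order of their designation, hence the permutation. Each row is
    -- stored with its value, so the function can still be read off.
    Records : (A → B) → List A → List (A × B) → Set
    Records f rows e = ∃[ ρ ] ρ ↭ rows × e ≡ map (λ a → a , f a) ρ

    Records-agree : ∀ {f g rows e} → Records f rows e → Records g rows e → ∀ {a} → a ∈ rows → f a ≡ g a
    Records-agree {g = g} (ρ , ρ↭ , refl) (ρ′ , ρ′↭ , eq) a∈ with ∈-map⁻ _ (subst (_ ∈_) eq (∈-map⁺ _ (∈-resp-↭ (↭-sym ρ↭) a∈)))
    ... | _ , _ , pair≡ = trans (cong proj₂ pair≡) (cong g (sym (cong proj₁ pair≡)))

  -- Assignments of a value in U to each row, built column by column: exactly k columns are skipped,
  -- every other column designates one row that it is assigned to, and the rows that are never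
  -- designated take arbitrary admissible values.
  module Assignments {A B : Set} (rel : A → B → Bool) (U : List B) where

    fills : List A → List (List (A × B))
    fills []       = [] ∷ []
    fills (a ∷ as) = concatMap (λ b → map ((a , b) ∷_) (fills as)) (filterᵇ (rel a) U)

    place : (List A → List (List (A × B))) → B → A → List A → List (List (A × B))
    place next c a rest = if rel a c then map ((a , c) ∷_) (next rest) else []

    assign unhit : ℕ → List A → List B → List (List (A × B))
    assign k       rows (c ∷ cs) = unhit k rows cs ++ pickAll (place (λ rest → assign k rest cs) c) rows
    assign zero    rows []       = fills rows
    assign (suc k) rows []       = []
    unhit zero    rows cs = []
    unhit (suc k) rows cs = assign k rows cs

    module _ (f : A → B) where

      fills-complete : ∀ rows → (∀ {a} → a ∈ rows → f a ∈ U × rel a (f a) ≡ true) → map (λ a → a , f a) rows ∈ fills rows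
      fills-complete [] _ = here refl
      fills-complete (a ∷ as) ok = ∈-concatMap⁺ _ (Any.map (λ { refl → ∈-map⁺ _ (fills-complete as (ok ∘ there)) })
        (∈-filter⁺ (T? ∘ rel a) (proj₁ (ok (here refl))) (Equivalence.from T-≡ (proj₂ (ok (here refl))))))

      module _ {P : B → Set} (P? : Decidable P) where

        -- Every column in `P` designates some row with that value, and the columns outside `P` are
        -- skipped. As columns are distinct, a row removed for one column is never the one that
        -- another column needs.
        assign-complete : ∀ k rows cs → Unique cs → (∀ {a} → a ∈ rows → f a ∈ U × rel a (f a) ≡ true) →
          (∀ {c} → c ∈ cs → P c → Any (λ a → f a ≡ c) rows) → length (filter (¬? ∘ P?) cs) ≡ k →
          Any (Records f rows) (assign k rows cs)
        assign-complete zero rows [] u ok hit refl =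
          Any.map (λ eq → rows , ↭-refl , sym eq) (fills-complete rows ok)
        assign-complete k rows (c ∷ cs) (c∉cs ∷ u) ok hit eq with P? c
        assign-complete (suc k) rows (c ∷ cs) (c∉cs ∷ u) ok hit eq | no _ =
          ++⁺ˡ (assign-complete k rows cs u ok (hit ∘ there) (suc-injective eq))
        assign-complete k rows (c ∷ cs) (c∉cs ∷ u) ok hit eq | yes pc =
          ++⁺ʳ (unhit k rows cs) (Any-pickAll _ p placed)
          where
          p = hit (here refl) pc
          a = Any.lookup p
          rest = rows ─ p
          fa≡c : f a ≡ c
          fa≡c = lookup-result p
          rel-ac : rel a c ≡ true
          rel-ac = subst (λ b → rel a b ≡ true) fa≡c (proj₂ (ok (∈-lookup (index p))))
          hit′ : ∀ {c′} → c′ ∈ cs → P c′ → Any (λ a → f a ≡ c′) rest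
          hit′ c′∈ pc′ with Any-resp-↭ (↭-sym (↭-lookup-─ p)) (hit (there c′∈) pc′)
          ... | here fa≡c′ = contradiction (trans (sym fa≡c) fa≡c′) (All.lookup c∉cs c′∈)
          ... | there q = q
          extend : ∀ {e} → Records f rest e → Records f rows ((a , c) ∷ e)
          extend (ρ , ρ↭ , e≡) = a ∷ ρ , ↭-trans (prep a ρ↭) (↭-lookup-─ p) , cong₂ (λ b → (a , b) ∷_) (sym fa≡c) e≡
          placed : Any (Records f rows) (place (λ rest → assign k rest cs) c a rest)
          placed rewrite rel-ac = Any-map⁺ (Any.map extend
            (assign-complete k rest cs u (λ a∈ → ok (∈-resp-↭ (↭-lookup-─ p) (there a∈))) hit′ eq))

    -- Minc's product, with row sums over the columns still to come, each raised by `t` so that a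
    -- row left over at the end keeps weight `suc t`.
    weight : List A → List B → ℕ → ℕ
    weight []       cs t = 1
    weight (a ∷ as) cs t = suc (hits (rel a) cs + t) * weight as cs t

    weight-≤ : ∀ {D} rows cs t → (∀ a → hits (rel a) cs ≤ D) → weight rows cs t ≤ suc (D + t) ^ length rows
    weight-≤ [] cs t bound = ≤-refl
    weight-≤ (a ∷ as) cs t bound = *-mono-≤ (s≤s (+-monoˡ-≤ t (bound a))) (weight-≤ as cs t bound)

    module _ (y t : ℕ) (row-bound : ∀ a → hits (rel a) U * 2 ≤ y * suc t) where

      -- A leftover row has weight `suc t` and Minc's factor 1/2; `row-bound` says that one further
      -- factor `y` pays for all its admissible values.
      fills-bound : ∀ rows → length (fills rows) * 2 ^ length rows ≤ y ^ length rows * weight rows [] t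
      fills-bound [] = ≤-refl
      fills-bound (a ∷ as) = begin
        length (fills (a ∷ as)) * (2 * 2 ^ length as)
          ≡⟨ cong (length (fills (a ∷ as)) *_) (*-comm 2 (2 ^ length as)) ⟩
        length (fills (a ∷ as)) * (2 ^ length as * 2)
          ≡⟨ *-assoc (length (fills (a ∷ as))) _ 2 ⟨
        length (fills (a ∷ as)) * 2 ^ length as * 2
          ≤⟨ *-monoˡ-≤ 2 (length-concatMap-≤ (λ b → map ((a , b) ∷_) (fills as)) _ _ each (filterᵇ (rel a) U)) ⟩
        length (filterᵇ (rel a) U) * rest * 2
          ≡⟨ cong (λ h → h * rest * 2) (length-filterᵇ (rel a) U) ⟩
        hits (rel a) U * rest * 2
          ≡⟨ eq₁ (hits (rel a) U) rest ⟩
        hits (rel a) U * 2 * rest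
          ≤⟨ *-monoˡ-≤ rest (row-bound a) ⟩
        y * suc t * rest
          ≡⟨ eq₂ y (suc t) (y ^ length as) (weight as [] t) ⟩
        y * y ^ length as * (suc t * weight as [] t) ∎
        where
        open ≤-Reasoning
        rest = y ^ length as * weight as [] t
        each : ∀ b → length (map ((a , b) ∷_) (fills as)) * 2 ^ length as ≤ rest
        each b = subst (λ n → n * 2 ^ length as ≤ rest) (sym (length-map ((a , b) ∷_) (fills as))) (fills-bound as)
        eq₁ : ∀ h r → h * r * 2 ≡ h * 2 * r
        eq₁ = solve-∀
        eq₂ : ∀ y t p w → y * t * (p * w) ≡ y * p * (t * w)
        eq₂ = solve-∀

      -- l is the number of rows that are never designated; they and the k skipped columns cost a factor y each.
      assign-bound : ∀ k l rows cs → length rows + k ≡ length cs + l →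
        length (assign k rows cs) * (2 ^ length rows * y ^ length cs) ≤ y ^ (k + l) * (suc y ^ length cs * weight rows cs t)
      assign-bound zero l rows [] eq rewrite sym eq | +-identityʳ (length rows) =
        subst₂ _≤_ (cong (length (fills rows) *_) (sym (*-identityʳ (2 ^ length rows))))
          (cong (y ^ length rows *_) (sym (*-identityˡ (weight rows [] t)))) (fills-bound rows)
      assign-bound (suc k) l rows [] eq = z≤n
      assign-bound k l rows (c ∷ cs) eq = begin
        length (unhit k rows cs ++ picked) * (2 ^ m * (y * y ^ length cs))
          ≡⟨ cong (_* (2 ^ m * (y * y ^ length cs))) (length-++ (unhit k rows cs)) ⟩
        (length (unhit k rows cs) + length picked) * (2 ^ m * (y * y ^ length cs))
          ≡⟨ eq₁ (length (unhit k rows cs)) (length picked) (2 ^ m) y (y ^ length cs) ⟩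
        -- A skip spends one of the `k` factors `y`. Skipping and designating thus contribute in the
        -- ratio 1 to `y`, and together they make up `suc y`.
        length (unhit k rows cs) * (2 ^ m * y ^ length cs) * y + y * (length picked * (2 ^ m * y ^ length cs))
          ≤⟨ +-mono-≤ (skip-bound k eq) (*-monoʳ-≤ y picked-bound) ⟩
        K * with⁺ rows + y * (K * with⁺ rows)
          ≡⟨ eq₂ (y ^ (k + l)) (suc y ^ length cs) (with⁺ rows) y ⟩
        y ^ (k + l) * (suc y ^ suc (length cs) * with⁺ rows)
          ≡⟨ cong (λ z → y ^ (k + l) * (suc y ^ suc (length cs) * z)) (with⁺≡weight rows) ⟩
        y ^ (k + l) * (suc y ^ suc (length cs) * weight rows (c ∷ cs) t) ∎
        where
        open ≤-Reasoning
        open Column (λ a → rel a c) (λ a → hits (rel a) cs + t)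
        m = length rows
        K = y ^ (k + l) * suc y ^ length cs
        picked = pickAll (place (λ rest → assign k rest cs) c) rows

        without≡weight : ∀ as → without as ≡ weight as cs t
        without≡weight []       = refl
        without≡weight (a ∷ as) = cong (suc (hits (rel a) cs + t) *_) (without≡weight as)

        with⁺≡weight : ∀ as → with⁺ as ≡ weight as (c ∷ cs) t
        with⁺≡weight []       = refl
        with⁺≡weight (a ∷ as) = cong₂ (λ u → suc u *_) (sym (+-assoc ⟦ rel a c ⟧ _ t)) (with⁺≡weight as)

        eq₁ : ∀ s q w y z → (s + q) * (w * (y * z)) ≡ s * (w * z) * y + y * (q * (w * z))
        eq₁ = solve-∀
        eq₂ : ∀ p s z y → p * s * z + y * (p * s * z) ≡ p * (suc y * s * z)
        eq₂ = solve-∀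
        eq₃ : ∀ p s z y → p * (s * z) * y ≡ y * p * s * z
        eq₃ = solve-∀
        eq₄ : ∀ n p z → n * (2 * p * z) ≡ 2 * (n * (p * z))
        eq₄ = solve-∀
        eq₅ : ∀ p s z → 2 * (p * (s * z)) ≡ 2 * (p * s) * (1 * z)
        eq₅ = solve-∀
        eq₆ : ∀ u v z → 2 * (u * v) * z ≡ u * v * (2 * z)
        eq₆ = solve-∀

        skip-bound : ∀ k → m + k ≡ suc (length cs) + l →
          length (unhit k rows cs) * (2 ^ m * y ^ length cs) * y ≤ y ^ (k + l) * suc y ^ length cs * with⁺ rows
        skip-bound zero    _  = z≤n
        skip-bound (suc k) eq = begin
          length (assign k rows cs) * (2 ^ m * y ^ length cs) * y
            ≤⟨ *-monoˡ-≤ y (assign-bound k l rows cs (suc-injective (trans (sym (+-suc m k)) eq))) ⟩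
          y ^ (k + l) * (suc y ^ length cs * weight rows cs t) * y
            ≡⟨ cong (λ z → y ^ (k + l) * (suc y ^ length cs * z) * y) (without≡weight rows) ⟨
          y ^ (k + l) * (suc y ^ length cs * without rows) * y
            ≤⟨ *-monoˡ-≤ y (*-monoʳ-≤ (y ^ (k + l)) (*-monoʳ-≤ (suc y ^ length cs) (without≤with⁺ rows))) ⟩
          y ^ (k + l) * (suc y ^ length cs * with⁺ rows) * y
            ≡⟨ eq₃ (y ^ (k + l)) (suc y ^ length cs) (with⁺ rows) y ⟩
          y * y ^ (k + l) * suc y ^ length cs * with⁺ rows ∎

        -- A row that is passed over stays in the rest of every later choice, so its factor moves
        -- into `V`; hence the induction over all `V`.
        pickAll-bound : ∀ {F w} V as →
          (∀ b bs → suc (length bs) ≡ length as → length (F b bs) * w ≤ V * (⟦ rel b c ⟧ * without bs)) →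
          length (pickAll F as) * w ≤ V * deleted as
        pickAll-bound V [] bound = z≤n
        pickAll-bound {F} {w} V (a ∷ as) bound = begin
          length (F a as ++ pickAll F′ as) * w
            ≡⟨ cong (_* w) (length-++ (F a as)) ⟩
          (length (F a as) + length (pickAll F′ as)) * w
            ≡⟨ *-distribʳ-+ w (length (F a as)) _ ⟩
          length (F a as) * w + length (pickAll F′ as) * w
            ≤⟨ +-mono-≤ (bound a as refl) (pickAll-bound (V * s) as bound′) ⟩
          V * (⟦ rel a c ⟧ * without as) + V * s * deleted as
            ≡⟨ eq₇ V (⟦ rel a c ⟧ * without as) s (deleted as) ⟩
          V * (⟦ rel a c ⟧ * without as + s * deleted as) ∎
          where
          s = suc (hits (rel a) cs + t)
          F′ = λ b bs → F b (a ∷ bs)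
          eq₇ : ∀ v p s x → v * p + v * s * x ≡ v * (p + s * x)
          eq₇ = solve-∀
          eq₈ : ∀ v i s x → v * (i * (s * x)) ≡ v * s * (i * x)
          eq₈ = solve-∀
          bound′ : ∀ b bs → suc (length bs) ≡ length as → length (F′ b bs) * w ≤ V * s * (⟦ rel b c ⟧ * without bs)
          bound′ b bs len = ≤-trans (bound b (a ∷ bs) (cong suc len)) (≤-reflexive (eq₈ V ⟦ rel b c ⟧ s (without bs)))

        place-bound : ∀ b bs → suc (length bs) ≡ m →
          length (place (λ rest → assign k rest cs) c b bs) * (2 ^ m * y ^ length cs) ≤ 2 * K * (⟦ rel b c ⟧ * without bs)
        place-bound b bs len with rel b c
        ... | false = z≤n
        ... | true  = begin
          length (map ((b , c) ∷_) (assign k bs cs)) * (2 ^ m * y ^ length cs)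
            ≡⟨ cong₂ (λ u v → u * (2 ^ v * y ^ length cs)) (length-map _ (assign k bs cs)) (sym len) ⟩
          length (assign k bs cs) * (2 * 2 ^ length bs * y ^ length cs)
            ≡⟨ eq₄ (length (assign k bs cs)) (2 ^ length bs) (y ^ length cs) ⟩
          2 * (length (assign k bs cs) * (2 ^ length bs * y ^ length cs))
            ≤⟨ *-monoʳ-≤ 2 (assign-bound k l bs cs (suc-injective (trans (cong (_+ k) len) eq))) ⟩
          2 * (y ^ (k + l) * (suc y ^ length cs * weight bs cs t))
            ≡⟨ cong (λ z → 2 * (y ^ (k + l) * (suc y ^ length cs * z))) (without≡weight bs) ⟨
          2 * (y ^ (k + l) * (suc y ^ length cs * without bs))
            ≡⟨ eq₅ (y ^ (k + l)) (suc y ^ length cs) (without bs) ⟩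
          2 * K * (1 * without bs) ∎

        picked-bound : length picked * (2 ^ m * y ^ length cs) ≤ K * with⁺ rows
        picked-bound = begin
          length picked * (2 ^ m * y ^ length cs)  ≤⟨ pickAll-bound (2 * K) rows place-bound ⟩
          2 * K * deleted rows                     ≡⟨ eq₆ (y ^ (k + l)) (suc y ^ length cs) (deleted rows) ⟩
          K * (2 * deleted rows)                   ≤⟨ *-monoʳ-≤ K (≤-trans (m≤m+n _ (with⁻ rows)) (2*deleted+with⁻≤with⁺ rows)) ⟩
          K * with⁺ rows                           ∎

  -- Numerical form of the permanent bound

  ^-distribʳ-* : ∀ a b m → (a * b) ^ m ≡ a ^ m * b ^ m
  ^-distribʳ-* a b zero    = refl
  ^-distribʳ-* a b (suc m) = trans (cong (a * b *_) (^-distribʳ-* a b m)) (eq a b (a ^ m) (b ^ m))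
    where
    eq : ∀ a b p q → a * b * (p * q) ≡ a * p * (b * q)
    eq = solve-∀

  -- Each row gains 1/2, each column loses `suc y` over `y`, and the added `t` loses at most `2 + y`
  -- over `y`; `saving` bounds the product of the three by 3/5.
  constant-saving : ∀ {N C W D t} y m .{{_ : NonZero y}} →
    N * (2 ^ m * y ^ m) ≤ C * (suc y ^ m * W) → W ≤ suc (D + t) ^ m →
    y * suc (D + t) ≤ (2 + y) * suc D → suc y * (2 + y) * 5 ≤ 3 * (2 * y * y) →
    N * 5 ^ m ≤ C * (3 * suc D) ^ m
  constant-saving {N} {C} {W} {D} {t} y m count W≤ y-large saving =
    *-cancelʳ-≤ _ _ ((2 * y * y) ^ m) {{m^n≢0 (2 * y * y) m {{m*n≢0 (2 * y) y {{m*n≢0 2 y}}}}}} (begin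
      N * 5 ^ m * (2 * y * y) ^ m
        ≡⟨ cong (N * 5 ^ m *_) (trans (^-distribʳ-* (2 * y) y m) (cong (_* y ^ m) (^-distribʳ-* 2 y m))) ⟩
      N * 5 ^ m * (2 ^ m * y ^ m * y ^ m)
        ≡⟨ eq₁ N (5 ^ m) (2 ^ m) (y ^ m) ⟩
      N * (2 ^ m * y ^ m) * (5 ^ m * y ^ m)
        ≤⟨ *-monoˡ-≤ (5 ^ m * y ^ m) (≤-trans count (*-monoʳ-≤ C (*-monoʳ-≤ (suc y ^ m) W≤))) ⟩
      C * (suc y ^ m * suc (D + t) ^ m) * (5 ^ m * y ^ m)
        ≡⟨ eq₂ C (suc y ^ m) (suc (D + t) ^ m) (5 ^ m) (y ^ m) ⟩
      C * (suc y ^ m * 5 ^ m * (y ^ m * suc (D + t) ^ m))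
        ≡⟨ cong (C *_) (cong₂ _*_ (^-distribʳ-* (suc y) 5 m) (^-distribʳ-* y (suc (D + t)) m)) ⟨
      C * ((suc y * 5) ^ m * (y * suc (D + t)) ^ m)
        ≡⟨ cong (C *_) (^-distribʳ-* (suc y * 5) (y * suc (D + t)) m) ⟨
      C * (suc y * 5 * (y * suc (D + t))) ^ m
        ≤⟨ *-monoʳ-≤ C (^-monoˡ-≤ m (begin
             suc y * 5 * (y * suc (D + t))      ≤⟨ *-monoʳ-≤ (suc y * 5) y-large ⟩
             suc y * 5 * ((2 + y) * suc D)      ≡⟨ eq₃ y D ⟩
             suc y * (2 + y) * 5 * suc D        ≤⟨ *-monoˡ-≤ (suc D) saving ⟩
             3 * (2 * y * y) * suc D            ≡⟨ eq₄ y D ⟩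
             3 * suc D * (2 * y * y)            ∎)) ⟩
      C * (3 * suc D * (2 * y * y)) ^ m
        ≡⟨ cong (C *_) (^-distribʳ-* (3 * suc D) (2 * y * y) m) ⟩
      C * ((3 * suc D) ^ m * (2 * y * y) ^ m)
        ≡⟨ *-assoc C _ _ ⟨
      C * (3 * suc D) ^ m * (2 * y * y) ^ m ∎)
    where
    open ≤-Reasoning
    eq₁ : ∀ n f p q → n * f * (p * q * q) ≡ n * (p * q) * (f * q)
    eq₁ = solve-∀
    eq₂ : ∀ c a b f q → c * (a * b) * (f * q) ≡ c * (a * f * (q * b))
    eq₂ = solve-∀
    eq₃ : ∀ y D → suc y * 5 * ((2 + y) * suc D) ≡ suc y * (2 + y) * 5 * suc D
    eq₃ = solve-∀
    eq₄ : ∀ y D → 3 * (2 * y * y) * suc D ≡ 3 * suc D * (2 * y * y)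
    eq₄ = solve-∀

  module _ {A B : Set} (rel : A → B → Bool) (U : List B) where
    open Assignments rel U

    -- With as many columns as rows, each skipped column leaves one row over, whence the exponent
    -- `k + k`.
    balanced-bound : ∀ y .{{_ : NonZero y}} → suc y * (2 + y) * 5 ≤ 3 * (2 * y * y) →
      ∀ D → (∀ a → hits (rel a) U ≤ D) → ∀ k rows cs → length cs ≡ length rows →
      (∀ a → hits (rel a) cs ≤ D) →
      length (assign k rows cs) * 5 ^ length rows ≤ y ^ (k + k) * (3 * suc D) ^ length rows
    balanced-bound y saving D hitsU≤ k rows cs same hits≤ =
      constant-saving {length (assign k rows cs)} {y ^ (k + k)} {weight rows cs t} y (length rows)
        (subst (λ c → length (assign k rows cs) * (2 ^ length rows * y ^ c) ≤ y ^ (k + k) * (suc y ^ c * weight rows cs t)) same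
          (assign-bound y t row-bound k k rows cs (cong (_+ k) (sym same))))
        (weight-≤ rows cs t hits≤) y-large saving
      where
      -- The quotient serves both demands: `y * suc t` is at least `D * 2`, and `t * y` is at most
      -- `D * 2`.
      t = (D * 2) / y
      row-bound : ∀ a → hits (rel a) U * 2 ≤ y * suc t
      row-bound a = ≤-trans (*-monoˡ-≤ 2 (hitsU≤ a))
        (≤-trans (≤-reflexive (m≡m%n+[m/n]*n (D * 2) y))
          (≤-trans (+-monoˡ-≤ (t * y) (<⇒≤ (m%n<n (D * 2) y))) (≤-reflexive (*-comm (suc t) y))))
      y-large : y * suc (D + t) ≤ (2 + y) * suc D
      y-large = begin
        y * suc (D + t)                ≡⟨ eq₁ y D t ⟩
        y * suc D + t * y              ≤⟨ +-monoʳ-≤ (y * suc D) (m/n*n≤m (D * 2) y) ⟩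
        y * suc D + D * 2              ≤⟨ +-monoʳ-≤ (y * suc D) (*-monoˡ-≤ 2 (n≤1+n D)) ⟩
        y * suc D + suc D * 2          ≡⟨ eq₂ y (suc D) ⟩
        (2 + y) * suc D                ∎
        where
        open ≤-Reasoning
        eq₁ : ∀ y D t → y * suc (D + t) ≡ y * suc D + t * y
        eq₁ = solve-∀
        eq₂ : ∀ y D → y * D + D * 2 ≡ (2 + y) * D
        eq₂ = solve-∀

  -- Rooting the tree

  unique⇒length≤ : ∀ {n} {xs : List (Fin n)} → Unique xs → length xs ≤ n
  unique⇒length≤ {n} u = ≤-trans
    (pigeonhole {R = _≡_} (λ { refl refl x≢x → x≢x refl }) u (All.tabulate λ {x} _ → ∈-allFin x))
    (≤-reflexive (length-tabulate {n = n} (λ i → i)))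

  -- Parents stand further down, so the list is embedded from its end. The last entry is exempt, as
  -- the parent of the root is its child.
  data Ordered {A : Set} (π : A → A) : List A → Set where
    [-] : ∀ {r} → Ordered π (r ∷ [])
    _∷_ : ∀ {v vs} → π v ∈ vs → Ordered π vs → Ordered π (v ∷ vs)

  IsPath-++ : ∀ {n} {G : Graph n} {u v w xs ys} → IsPath G u xs v → IsPath G v ys w → IsPath G u (xs ++ ys) w
  IsPath-++ end        q = q
  IsPath-++ (cons e p) q = cons e (IsPath-++ p q)

  module _ {n} {G : Graph n} (snoc : List (Fin n) → Fin n → List (Fin n))
           (snoc-[] : ∀ x → snoc [] x ≡ x ∷ []) (snoc-∷ : ∀ y ys x → snoc (y ∷ ys) x ≡ y ∷ snoc ys x) where

    path-snoc : ∀ {u x xs w} → IsPath G u (x ∷ xs) w → ∃[ ys ] snoc ys w ≡ x ∷ xs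
    path-snoc (cons e end) = [] , snoc-[] _
    path-snoc {x = x} (cons e p@(cons _ _)) with path-snoc p
    ... | ys , eq = x ∷ ys , trans (snoc-∷ x ys _) (cong (x ∷_) eq)

    -- snoc stands for the local append function in the definition of HasCycle.
    cycle : ∀ {v p x xs w} → Unique (v ∷ p ∷ x ∷ xs) → adj G v p ≡ true → IsPath G p (x ∷ xs) w → adj G w v ≡ true →
      Σ (Fin n) λ v₀ → Σ (Fin n) λ v₁ → Σ (List (Fin n)) λ vs → Σ (Fin n) λ vₖ →
        Unique (v₀ ∷ v₁ ∷ snoc vs vₖ) × adj G v₀ v₁ ≡ true × IsPath G v₁ (snoc vs vₖ) vₖ
        × adj G vₖ v₀ ≡ true × (1 ≤ length (snoc vs vₖ))
    cycle {v} {p} {w = w} u vp path wv with path-snoc path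
    ... | ys , eq = v , p , ys , w , subst (λ l → Unique (v ∷ p ∷ l)) (sym eq) u , vp
                  , subst (λ l → IsPath G p l w) (sym eq) path , wv , subst (λ l → 1 ≤ length l) (sym eq) (s≤s z≤n)

  path⇒cycle : ∀ {n} {G : Graph n} {v p x xs w} → Unique (v ∷ p ∷ x ∷ xs) → adj G v p ≡ true →
    IsPath G p (x ∷ xs) w → adj G w v ≡ true → HasCycle G
  -- The underscore is the append function local to `HasCycle`, found by unification; its defining
  -- equations hold by `refl`.
  path⇒cycle u vp path wv = cycle _ (λ _ → refl) (λ _ _ _ → refl) u vp path wv

  module _ {n} (T : Graph n) where

    adj⇒≢ : ∀ {i j} → adj T i j ≡ true → i ≢ j
    adj⇒≢ {i} e refl with trans (sym e) (irrefl T i)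
    ... | ()

    adj-flip : ∀ {i j} → adj T i j ≡ true → adj T j i ≡ true
    adj-flip {i} {j} e = trans (adj-sym T j i) e

    -- Starting from an edge rather than a vertex gives the root a neighbour that can serve as its
    -- parent.
    data Build : List (Fin n) → Set where
      edge : ∀ {c r} → adj T c r ≡ true → Build (c ∷ r ∷ [])
      grow : ∀ {v p vs} → v ∉ vs → p ∈ vs → adj T v p ≡ true → Build vs → Build (v ∷ vs)

    -- The root also has a parent, namely the vertex added right after it.
    parent : ∀ {vs} → Build vs → Fin n → Fin n
    parent (edge {c} {r} _) x with x ≟ c
    ... | yes _ = r
    ... | no _  = c
    parent (grow {v} {p} _ _ _ b) x with x ≟ v
    ... | yes _ = p
    ... | no _  = parent b x

    build-unique : ∀ {vs} → Build vs → Unique vs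
    build-unique (edge e)       = (adj⇒≢ e ∷ []) ∷ [] ∷ []
    build-unique (grow v∉ _ _ b) = All.tabulate (λ { x∈ refl → v∉ x∈ }) ∷ build-unique b

    parent-adj : ∀ {vs} (b : Build vs) {x} → x ∈ vs → adj T x (parent b x) ≡ true
    parent-adj (edge {c} {r} e) {x} x∈ with x ≟ c | x∈
    ... | yes refl | _                  = e
    ... | no x≢c   | here x≡c           = contradiction x≡c x≢c
    ... | no _     | there (here refl)  = adj-flip e
    parent-adj (grow {v} v∉ p∈ e b) {x} x∈ with x ≟ v | x∈
    ... | yes refl | _          = e
    ... | no x≢v   | here x≡v   = contradiction x≡v x≢v
    ... | no _     | there x∈vs = parent-adj b x∈vs

    parent-grow : ∀ {v p vs} (v∉ : v ∉ vs) (p∈ : p ∈ vs) (e : adj T v p ≡ true) (b : Build vs) {x} → x ∈ vs →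
      parent (grow v∉ p∈ e b) x ≡ parent b x
    parent-grow {v} v∉ p∈ e b {x} x∈ with x ≟ v
    ... | yes refl = contradiction x∈ v∉
    ... | no _     = refl

    parent-new : ∀ {v p vs} (v∉ : v ∉ vs) (p∈ : p ∈ vs) (e : adj T v p ≡ true) (b : Build vs) →
      parent (grow v∉ p∈ e b) v ≡ p
    parent-new {v} v∉ p∈ e b with v ≟ v
    ... | yes _  = refl
    ... | no v≢v = contradiction refl v≢v

    Joined : List (Fin n) → Fin n → Fin n → Set
    Joined vs a b = ∃[ xs ] IsPath T a xs b × Unique (a ∷ xs) × All (_∈ vs) xs

    -- The path is kept inside `vs` so that a new vertex with two neighbours in `vs` would close it
    -- to a cycle.
    joined : ∀ {vs} → Build vs → ∀ {a b} → a ∈ vs → b ∈ vs → Joined vs a b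
    joined (edge e) (here refl) (here refl) = [] , end , [] ∷ [] , []
    joined (edge e) (here refl) (there (here refl)) =
      _ , cons e end , (adj⇒≢ e ∷ []) ∷ [] ∷ [] , there (here refl) ∷ []
    joined (edge e) (there (here refl)) (here refl) =
      _ , cons (adj-flip e) end , (adj⇒≢ (adj-flip e) ∷ []) ∷ [] ∷ [] , here refl ∷ []
    joined (edge e) (there (here refl)) (there (here refl)) = [] , end , [] ∷ [] , []
    joined (grow _ _ _ _) (here refl) (here refl) = [] , end , [] ∷ [] , []
    joined (grow {v} {p} v∉ p∈ e b) (here refl) (there b∈) with joined b p∈ b∈
    ... | xs , path , u , inside =
      p ∷ xs , cons e path , All.map (λ { x∈ refl → v∉ x∈ }) (p∈ ∷ inside) ∷ u , there p∈ ∷ All.map there inside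
    joined (grow {v} {p} v∉ p∈ e b) (there a∈) (here refl) with joined b a∈ p∈
    ... | xs , path , u , inside =
      xs ++ v ∷ [] , IsPath-++ path (cons (adj-flip e) end)
      , AllPairs.++⁺ u ([] ∷ []) (All.map (λ { x∈ → (λ { refl → v∉ x∈ }) ∷ [] }) (a∈ ∷ inside))
      , All.++⁺ (All.map there inside) (here refl ∷ [])
    joined (grow _ _ _ b) (there a∈) (there b∈) with joined b a∈ b∈
    ... | xs , path , u , inside = xs , path , u , All.map there inside

    module _ (acyclic : ¬ HasCycle T) where

      attached-once : ∀ {v p u vs} → v ∉ vs → p ∈ vs → adj T v p ≡ true → Build vs → u ∈ vs → adj T v u ≡ true → p ≡ u
      attached-once v∉ p∈ e b u∈ e′ with joined b p∈ u∈
      ... | [] , end , _ = refl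
      ... | x ∷ xs , path , u , inside = contradiction
        (path⇒cycle (All.map (λ { x∈ refl → v∉ x∈ }) (p∈ ∷ inside) ∷ u) e path (adj-flip e′)) acyclic

      -- By acyclicity a vertex has a single neighbour among the earlier ones, so each edge is the
      -- one by which its later end was attached.
      adj⇒parent : ∀ {vs} (b : Build vs) {i j} → i ∈ vs → j ∈ vs → adj T i j ≡ true → parent b i ≡ j ⊎ parent b j ≡ i
      adj⇒parent (edge e) (here refl) (here refl) e′ = contradiction refl (adj⇒≢ e′)
      adj⇒parent (edge {c} e) (here refl) (there (here refl)) e′ with c ≟ c
      ... | yes _  = inj₁ refl
      ... | no c≢c = contradiction refl c≢c
      adj⇒parent (edge {c} e) (there (here refl)) (here refl) e′ with c ≟ c
      ... | yes _  = inj₂ refl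
      ... | no c≢c = contradiction refl c≢c
      adj⇒parent (edge e) (there (here refl)) (there (here refl)) e′ = contradiction refl (adj⇒≢ e′)
      adj⇒parent (grow _ _ _ _) (here refl) (here refl) e′ = contradiction refl (adj⇒≢ e′)
      adj⇒parent (grow v∉ p∈ e b) (here refl) (there j∈) e′ =
        inj₁ (trans (parent-new v∉ p∈ e b) (attached-once v∉ p∈ e b j∈ e′))
      adj⇒parent (grow v∉ p∈ e b) (there i∈) (here refl) e′ =
        inj₂ (trans (parent-new v∉ p∈ e b) (attached-once v∉ p∈ e b i∈ (adj-flip e′)))
      adj⇒parent (grow v∉ p∈ e b) (there i∈) (there j∈) e′ with adj⇒parent b i∈ j∈ e′
      ... | inj₁ eq = inj₁ (trans (parent-grow v∉ p∈ e b i∈) eq)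
      ... | inj₂ eq = inj₂ (trans (parent-grow v∉ p∈ e b j∈) eq)

    module _ {Q : Fin n → Set} (Q? : Decidable Q) (π : Fin n → Fin n) where

      -- Parents survive the filter because `Q` holds at every value of `π`. The ends of the initial
      -- edge are parents of each other, so both survive. `π` stays fixed while the construction is
      -- taken apart.
      filter-ordered : ∀ {vs} (b : Build vs) → (∀ {x} → x ∈ vs → π x ≡ parent b x) →
        (∀ {x} → x ∈ vs → Q (π x)) → Ordered π (filter Q? vs)
      filter-ordered (edge {c} {r} e) π≡ Qπ = subst (Ordered π) (sym both) (here πc≡r ∷ [-])
        where
        πc≡r : π c ≡ r
        πc≡r with c ≟ c | π≡ (here refl)
        ... | yes _  | eq = eq
        ... | no c≢c | _  = contradiction refl c≢c
        πr≡c : π r ≡ c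
        πr≡c with r ≟ c | π≡ (there (here refl))
        ... | yes r≡c | _  = contradiction (sym r≡c) (adj⇒≢ e)
        ... | no _    | eq = eq
        both : filter Q? (c ∷ r ∷ []) ≡ c ∷ r ∷ []
        both = filter-all Q? (subst Q πr≡c (Qπ (there (here refl))) ∷ subst Q πc≡r (Qπ (here refl)) ∷ [])
      filter-ordered (grow {v} {p} {vs} v∉ p∈ e b) π≡ Qπ with ih ← filter-ordered b
          (λ x∈ → trans (π≡ (there x∈)) (parent-grow v∉ p∈ e b x∈)) (λ x∈ → Qπ (there x∈)) | Q? v
      ... | no _  = ih
      ... | yes _ = subst (_∈ filter Q? vs) (sym πv≡p) (∈-filter⁺ Q? p∈ (subst Q πv≡p (Qπ (here refl)))) ∷ ih
        where
        πv≡p : π v ≡ p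
        πv≡p = trans (π≡ (here refl)) (parent-new v∉ p∈ e b)

    crossing : ∀ {vs a b} → Walk T a b → a ∈ vs → b ∉ vs → ∃[ v ] ∃[ p ] v ∉ vs × p ∈ vs × adj T v p ≡ true
    crossing here a∈ b∉ = contradiction a∈ b∉
    crossing {vs} (step {u} {v} e w) a∈ b∉ with _∈?_ _≟_ v vs
    ... | yes v∈ = crossing w v∈ b∉
    ... | no v∉  = v , u , v∉ , a∈ , adj-flip e

    module _ (connected : Connected T) where

      -- `fuel` bounds the number of missing vertices: the entries are distinct, so the list cannot
      -- outgrow `n`.
      extend : ∀ fuel {vs} → Build vs → n ≤ fuel + length vs → ∃[ us ] Build us × (∀ v → v ∈ us)
      extend fuel {vs} b enough with any? (λ v → ¬? (_∈?_ _≟_ v vs))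
      ... | no none = vs , b , λ v → decidable-stable (_∈?_ _≟_ v vs) (λ v∉ → none (v , v∉))
      extend zero {vs} b enough | yes (v , v∉) = contradiction
        (≤-trans (unique⇒length≤ {xs = v ∷ vs} (All.tabulate (λ { x∈ refl → v∉ x∈ }) ∷ build-unique b)) enough) (<-irrefl refl)
      extend (suc fuel) {x ∷ vs} b enough | yes (v , v∉) with crossing (connected x v) (here refl) v∉
      ... | u , p , u∉ , p∈ , e = extend fuel (grow u∉ p∈ e b) (subst (n ≤_) (sym (+-suc fuel _)) enough)
      extend (suc fuel) {[]} () enough | yes _

    build-all : 2 ≤ n → Connected T → ∃[ us ] Build us × (∀ v → v ∈ us)
    build-all (s≤s (s≤s _)) connected with connected zero (suc zero)
    -- The two vertices differ, so the walk has a first edge to start from.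
    ... | step e _ = extend connected n (edge e) (m≤m+n n 2)

  -- Auxiliary facts on lists

  length-partition : {A : Set} {Q : A → Set} (Q? : Decidable Q) → ∀ xs →
    length (filter Q? xs) + length (filter (¬? ∘ Q?) xs) ≡ length xs
  length-partition Q? [] = refl
  length-partition Q? (x ∷ xs) with Q? x
  ... | yes _ = cong suc (length-partition Q? xs)
  ... | no _  = trans (+-suc _ _) (cong suc (length-partition Q? xs))

  length-allFin : ∀ n → length (allFin n) ≡ n
  length-allFin n = length-tabulate {n = n} (λ i → i)

  true⇔true⇒≡ : ∀ {x y : Bool} → (x ≡ true → y ≡ true) → (y ≡ true → x ≡ true) → x ≡ y
  true⇔true⇒≡ {false} {false} _ _ = refl
  true⇔true⇒≡ {false} {true}  _ g = g refl
  true⇔true⇒≡ {true}          f _ = sym (f refl)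

  length-concatMap-≤-const : {A B : Set} (f : A → List B) (v : ℕ) → (∀ a → length (f a) ≤ v) →
    ∀ xs → length (concatMap f xs) ≤ length xs * v
  length-concatMap-≤-const f v bound xs = ≤-trans (≤-reflexive (sym (*-identityʳ _)))
    (length-concatMap-≤ f 1 v (λ a → ≤-trans (≤-reflexive (*-identityʳ _)) (bound a)) xs)

  _when_ : {P X : Set} → List X → Dec P → List X
  xs when (yes _) = xs
  xs when (no _)  = []

  when-bound : {P X : Set} {xs : List X} {w v : ℕ} (d : Dec P) → (P → length xs * w ≤ v) → length (xs when d) * w ≤ v
  when-bound (yes p) bound = bound p
  when-bound (no _)  bound = z≤n

  Any-when : {P X : Set} {R : X → Set} {xs : List X} (d : Dec P) → P → Any R xs → Any R (xs when d)
  Any-when (yes _) p r = r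
  Any-when (no ¬p) p r = contradiction p ¬p

  -- Greedy embeddings

  module Embeddings {n} (G : Graph n) (π : Fin n → Fin n) where

    image-of : List (Fin n) → List (Fin n) → Fin n → Fin n
    image-of (u ∷ us) (e ∷ es) v = if does (v ≟ u) then e else image-of us es v
    image-of _        _        v = v

    image-of-map : ∀ (φ : Fin n → Fin n) {v vs} → v ∈ vs → image-of vs (map φ vs) v ≡ φ v
    image-of-map φ {v} {u ∷ us} v∈ with v ≟ u | v∈
    ... | yes refl | _         = refl
    ... | no v≢u   | here v≡u  = contradiction v≡u v≢u
    ... | no _     | there v∈′ = image-of-map φ v∈′

    -- The first vertex embedded is at the end of the list.
    embeddings : List (Fin n) → List (List (Fin n))
    embeddings []               = []
    embeddings (r ∷ [])         = map (_∷ []) (allFin n)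
    embeddings (v ∷ vs@(_ ∷ _)) =
      concatMap (λ es → map (_∷ es) (filterᵇ (adj G (image-of vs es (π v))) (allFin n))) (embeddings vs)

    embeddings-complete : ∀ {φ vs} → Ordered π vs → (∀ v → adj G (φ (π v)) (φ v) ≡ true) → map φ vs ∈ embeddings vs
    embeddings-complete {φ} {r ∷ []} [-] edges = ∈-map⁺ _ (∈-allFin (φ r))
    embeddings-complete {φ} {v ∷ []} (() ∷ _) edges
    embeddings-complete {φ} {v ∷ vs@(_ ∷ _)} (πv∈ ∷ ordered) edges =
      ∈-concatMap⁺ _ (Any.map (λ { refl → ∈-map⁺ _ (∈-filter⁺ (T? ∘ adj G (image-of vs (map φ vs) (π v))) (∈-allFin (φ v))
        (Equivalence.from T-≡ (subst (λ u → adj G u (φ v) ≡ true) (sym (image-of-map φ πv∈)) (edges v)))) })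
        (embeddings-complete {φ} ordered edges))

    -- The first vertex has `n` places, each later one a neighbour of the image of its parent. The
    -- base `suc D` matches that of the permanent bound.
    embeddings-bound : ∀ {D} → (∀ i → degree G i ≤ D) → ∀ vs → length (embeddings vs) ≤ n * suc D ^ length vs
    embeddings-bound {D} deg≤ [] = z≤n
    embeddings-bound {D} deg≤ (r ∷ []) = ≤-trans (≤-reflexive (trans (length-map (_∷ []) (allFin n)) (length-allFin n)))
      (m≤m*n n (suc D * 1))
    embeddings-bound {D} deg≤ (v ∷ vs@(_ ∷ _)) = begin
      length (concatMap extensions (embeddings vs))  ≤⟨ length-concatMap-≤-const extensions (suc D) each (embeddings vs) ⟩
      length (embeddings vs) * suc D           ≤⟨ *-monoˡ-≤ (suc D) (embeddings-bound deg≤ vs) ⟩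
      n * suc D ^ length vs * suc D            ≡⟨ *-assoc n _ _ ⟩
      n * (suc D ^ length vs * suc D)          ≡⟨ cong (n *_) (*-comm _ (suc D)) ⟩
      n * (suc D * suc D ^ length vs)          ∎
      where
      open ≤-Reasoning
      extensions = λ es → map (_∷ es) (filterᵇ (adj G (image-of vs es (π v))) (allFin n))
      each : ∀ es → length (extensions es) ≤ suc D
      each es = begin
        length (extensions es)
          ≡⟨ length-map (_∷ es) (filterᵇ (adj G (image-of vs es (π v))) (allFin n)) ⟩
        length (filterᵇ (adj G (image-of vs es (π v))) (allFin n))    ≡⟨ length-filterᵇ _ (allFin n) ⟩
        degree G (image-of vs es (π v))                               ≤⟨ deg≤ _ ⟩
        D                                                             ≤⟨ n≤1+n D ⟩
        suc D                                                         ∎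

  -- Coding the copies of the tree

  module Copies {n} (T G : Graph n) (π : Fin n → Fin n) (π-adj : ∀ v → adj T v (π v) ≡ true)
                {D} (deg≤ : ∀ i → degree G i ≤ D) where

    Internal : Fin n → Set
    Internal v = ∃[ u ] π u ≡ v

    internal? : Decidable Internal
    internal? v = any? (λ u → π u ≟ v)

    leaves : List (Fin n)
    leaves = filter (¬? ∘ internal?) (allFin n)

    record Copy (H : Graph n) : Set where
      constructor copied
      field isCopy : IsCopy T G H

    module _ {H} (copy : Copy H) where
      open Copy copy
      open Σ isCopy renaming (proj₁ to H⊆G)
      open Σ (proj₂ isCopy) renaming (proj₁ to σ; proj₂ to σ-iso)

      to from : Fin n → Fin n
      to = σ ⟨$⟩ʳ_
      from = σ ⟨$⟩ˡ_

      from-to : ∀ v → from (to v) ≡ v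
      from-to v = inverseˡ σ

      to-from : ∀ x → to (from x) ≡ x
      to-from x = inverseʳ σ

      adj-copy : ∀ x y → adj H x y ≡ adj T (from x) (from y)
      adj-copy x y = trans (cong₂ (adj H) (sym (to-from x)) (sym (to-from y))) (sym (σ-iso (from x) (from y)))

      to-adj : ∀ {u v} → adj T u v ≡ true → adj G (to u) (to v) ≡ true
      to-adj {u} {v} e = H⊆G (to u) (to v) (trans (sym (σ-iso u v)) e)

      parent-in-copy : Fin n → Fin n
      parent-in-copy x = to (π (from x))

    copies-bound : ∀ {E : Set} (R : ∀ {H} → Copy H → E → Set) (codes : List E) →
      (∀ {H} (c : Copy H) → Any (R c) codes) →
      (∀ {H H′ e} (c : Copy H) (c′ : Copy H′) → R c e → R c′ e → ∀ x y → adj H x y ≡ adj H′ x y) →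
      ∀ {Hs} → AllCopies T G Hs → AllPairs DifferentEdgeSets Hs → length Hs ≤ length codes
    copies-bound {E} R codes coded determined copies different =
      pigeonhole {R = λ H e → Σ[ c ∈ Copy H ] R c e}
        (λ (c , r) (c′ , r′) (x , y , x≢y) → x≢y (determined c c′ r r′ x y)) different (all copies)
      where
      all : ∀ {Hs} → AllCopies T G Hs → All (λ H → Any (λ e → Σ[ c ∈ Copy H ] R c e) codes) Hs
      all []       = []
      all (c ∷ cs) = Any.map (copied c ,_) (coded (copied c)) ∷ all cs

    module FewLeaves (only-parents : ∀ {u v} → adj T u v ≡ true → π u ≡ v ⊎ π v ≡ u) where

      open Assignments (adj G) (allFin n)

      -- `to c` carries the leaves of `T` to the missed columns. Their number is thus the same for
      -- all copies, and one enumeration codes them all.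
      missed : ∀ {H} (c : Copy H) → length (filter (¬? ∘ internal? ∘ from c) (allFin n)) ≡ length leaves
      missed c = length-bijection (from c) (to c) (to-from c) (from-to c)
        (filter⁺ (¬? ∘ internal? ∘ from c) (allFin⁺ n)) (filter⁺ (¬? ∘ internal?) (allFin⁺ n))
        (λ {x} x∈ → ∈-filter⁺ (¬? ∘ internal?) (∈-allFin _) (proj₂ (∈-filter⁻ (¬? ∘ internal? ∘ from c) {xs = allFin n} x∈)))
        (λ {v} v∈ → ∈-filter⁺ (¬? ∘ internal? ∘ from c) (∈-allFin _)
          (subst (¬_ ∘ Internal) (sym (from-to c v)) (proj₂ (∈-filter⁻ (¬? ∘ internal?) {xs = allFin n} v∈))))

      coded : ∀ {H} (c : Copy H) → Any (Records (parent-in-copy c) (allFin n)) (assign (length leaves) (allFin n) (allFin n))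
      coded c = assign-complete (parent-in-copy c) (internal? ∘ from c) _ (allFin n) (allFin n) (allFin⁺ n)
        (λ {x} _ → ∈-allFin _ , subst (λ z → adj G z (parent-in-copy c x) ≡ true) (to-from c x) (to-adj c (π-adj (from c x))))
        -- If `π u` is `from c x`, the row `to c u` has the value `x`.
        (λ { {x} _ (u , πu≡) → Any.map (λ { refl → trans (cong (to c ∘ π) (from-to c u)) (trans (cong (to c) πu≡) (to-from c x)) })
                                 (∈-allFin (to c u)) })
        (missed c)

      adj⇒parent-in-copy : ∀ {H} (c : Copy H) {x y} → adj H x y ≡ true → parent-in-copy c x ≡ y ⊎ parent-in-copy c y ≡ x
      adj⇒parent-in-copy c {x} {y} e with only-parents (trans (sym (adj-copy c x y)) e)
      ... | inj₁ eq = inj₁ (trans (cong (to c) eq) (to-from c y))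
      ... | inj₂ eq = inj₂ (trans (cong (to c) eq) (to-from c x))

      parent-in-copy-adj : ∀ {H} (c : Copy H) x → adj H x (parent-in-copy c x) ≡ true
      parent-in-copy-adj c x = trans (adj-copy c x _)
        (trans (cong (adj T (from c x)) (from-to c _)) (π-adj (from c x)))

      ⊆-of-parents : ∀ {H H′} (c : Copy H) (c′ : Copy H′) → (∀ x → parent-in-copy c x ≡ parent-in-copy c′ x) → H ⊆G H′
      ⊆-of-parents {H′ = H′} c c′ same x y e with adj⇒parent-in-copy c e
      ... | inj₁ refl = subst (λ z → adj H′ x z ≡ true) (sym (same x)) (parent-in-copy-adj c′ x)
      ... | inj₂ refl = adj-flip H′ (subst (λ z → adj H′ y z ≡ true) (sym (same y)) (parent-in-copy-adj c′ y))

      few-leaves-bound : ∀ {Hs} → AllCopies T G Hs → AllPairs DifferentEdgeSets Hs →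
        length Hs * 5 ^ n ≤ 100 ^ (length leaves + length leaves) * (3 * suc D) ^ n
      few-leaves-bound {Hs} copies different = ≤-trans
        (*-monoˡ-≤ (5 ^ n) (copies-bound (λ c → Records (parent-in-copy c) (allFin n)) _ coded determined copies different))
        (subst (λ m → length codes * 5 ^ m ≤ 100 ^ (length leaves + length leaves) * (3 * suc D) ^ m) (length-allFin n)
          (balanced-bound (adj G) (allFin n) 100 (≤ᵇ⇒≤ _ _ tt) D deg≤ (length leaves) (allFin n) (allFin n) refl deg≤))
        where
        codes = assign (length leaves) (allFin n) (allFin n)
        determined : ∀ {H H′ e} (c : Copy H) (c′ : Copy H′) → Records (parent-in-copy c) (allFin n) e →
          Records (parent-in-copy c′) (allFin n) e → ∀ x y → adj H x y ≡ adj H′ x y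
        determined c c′ r r′ x y = true⇔true⇒≡
          (⊆-of-parents c c′ (λ x → Records-agree r r′ (∈-allFin x)) x y)
          (⊆-of-parents c′ c (λ x → Records-agree r′ r (∈-allFin x)) x y)

    module ManyLeaves {ws} (ordered : Ordered π ws) (ws-unique : Unique ws)
                      (internal⇒ws : ∀ {v} → Internal v → v ∈ ws) (ws⇒internal : ∀ {v} → v ∈ ws → Internal v) where

      open Embeddings G π

      internal+leaves : length ws + length leaves ≡ n
      internal+leaves = begin
        length ws + length leaves                           ≡⟨ cong (_+ length leaves) (length-bijection (λ v → v) (λ v → v)
            (λ _ → refl) (λ _ → refl) ws-unique (filter⁺ internal? (allFin⁺ n))
            (λ v∈ → ∈-filter⁺ internal? (∈-allFin _) (ws⇒internal v∈))
            (λ v∈ → internal⇒ws (proj₂ (∈-filter⁻ internal? {xs = allFin n} v∈)))) ⟩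
        length (filter internal? (allFin n)) + length leaves ≡⟨ length-partition internal? (allFin n) ⟩
        length (allFin n)                                   ≡⟨ length-allFin n ⟩
        n                                                   ∎
        where open ≡-Reasoning

      unused : List (Fin n) → List (Fin n)
      unused es = filter (λ x → ¬? (_∈?_ _≟_ x es)) (allFin n)

      leaf-rel : List (Fin n) → Fin n → Fin n → Bool
      leaf-rel es v x = adj G (image-of ws es (π v)) x

      Code : Set
      Code = List (Fin n) × List (Fin n × Fin n)

      completions : List (Fin n) → List (List (Fin n × Fin n))
      completions es = Assignments.assign (leaf-rel es) (allFin n) 0 leaves (unused es)
        when (length (unused es) ≟ℕ length leaves)

      codes : List Code
      codes = concatMap (λ es → map (es ,_) (completions es)) (embeddings ws)

      completions-bound : ∀ es → length (completions es) * 5 ^ length leaves ≤ (3 * suc D) ^ length leaves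
      completions-bound es = when-bound (length (unused es) ≟ℕ length leaves) λ same → ≤-trans
        (balanced-bound (leaf-rel es) (allFin n) 100 (≤ᵇ⇒≤ _ _ tt) D (λ v → deg≤ _) 0 leaves (unused es) same
          (λ v → ≤-trans (hits-filter (leaf-rel es v) _ (allFin n)) (deg≤ _)))
        (≤-reflexive (*-identityˡ _))

      codes-bound : length codes * 5 ^ length leaves ≤ n * suc D ^ length ws * (3 * suc D) ^ length leaves
      codes-bound = ≤-trans
        (length-concatMap-≤ (λ es → map (es ,_) (completions es)) (5 ^ length leaves) _
          (λ es → subst (λ l → l * 5 ^ length leaves ≤ _) (sym (length-map (es ,_) (completions es))) (completions-bound es))
          (embeddings ws))
        (*-monoˡ-≤ _ (embeddings-bound deg≤ ws))

      Coded : ∀ {H} → Copy H → Code → Set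
      Coded c (es , e) = es ≡ map (to c) ws × Records (to c) leaves e

      coded : ∀ {H} (c : Copy H) → Any (Coded c) codes
      coded c = concatMap⁺ _ (Any.map
        (λ { refl → Any-map⁺ (Any.map (refl ,_) completed) })
        (embeddings-complete {to c} ordered (λ v → adj-flip G (to-adj c (π-adj v)))))
        where
        es = map (to c) ws
        leaf∉ws : ∀ {v} → v ∈ leaves → v ∉ ws
        leaf∉ws v∈ v∈ws = proj₂ (∈-filter⁻ (¬? ∘ internal?) {xs = allFin n} v∈) (ws⇒internal v∈ws)
        to-leaf : ∀ {v} → v ∈ leaves → to c v ∈ unused es
        to-leaf {v} v∈ = ∈-filter⁺ _ (∈-allFin _) λ tv∈ → let (u , u∈ , eq) = ∈-map⁻ (to c) tv∈ in
          leaf∉ws v∈ (subst (_∈ ws) (trans (sym (from-to c u)) (trans (cong (from c) (sym eq)) (from-to c v))) u∈)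
        from-unused : ∀ {x} → x ∈ unused es → from c x ∈ leaves
        from-unused {x} x∈ = ∈-filter⁺ (¬? ∘ internal?) (∈-allFin _) λ int →
          proj₂ (∈-filter⁻ (λ x → ¬? (_∈?_ _≟_ x es)) {xs = allFin n} x∈)
            (subst (_∈ es) (to-from c x) (∈-map⁺ (to c) (internal⇒ws int)))
        same : length (unused es) ≡ length leaves
        same = sym (length-bijection (to c) (from c) (from-to c) (to-from c)
          (filter⁺ (¬? ∘ internal?) (allFin⁺ n)) (filter⁺ _ (allFin⁺ n)) to-leaf from-unused)
        completed : Any (Records (to c) leaves) (completions es)
        completed = Any-when (length (unused es) ≟ℕ length leaves) same (Assignments.assign-complete
          (leaf-rel es) (allFin n) (to c) {P = λ _ → ⊤} (λ _ → yes tt) 0 leaves (unused es)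
          (filter⁺ _ (allFin⁺ n))
          (λ {v} v∈ → ∈-allFin _ , subst (λ u → adj G u (to c v) ≡ true) (sym (image-of-map (to c) (internal⇒ws (v , refl))))
            (adj-flip G (to-adj c (π-adj v))))
          (λ {x} x∈ _ → Any.map (λ { refl → to-from c x }) (from-unused x∈))
          (cong length (filter-none (¬? ∘ λ _ → yes tt) {xs = unused es} (All.tabulate (λ _ f → f tt)))))

      -- Here the code fixes the isomorphism itself: the list gives the images of the internal
      -- vertices, the record those of the leaves.
      determined : ∀ {H H′ e} (c : Copy H) (c′ : Copy H′) → Coded c e → Coded c′ e → ∀ x y → adj H x y ≡ adj H′ x y
      determined {H} {H′} {es , e} c c′ (es≡ , r) (es≡′ , r′) x y =
        trans (adj-copy c x y) (trans (cong₂ (adj T) (same-from x) (same-from y)) (sym (adj-copy c′ x y)))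
        where
        same-to : ∀ v → to c v ≡ to c′ v
        same-to v with internal? v
        ... | yes int = trans (sym (image-of-map (to c) (internal⇒ws int)))
          (trans (cong (λ l → image-of ws l v) (trans (sym es≡) es≡′)) (image-of-map (to c′) (internal⇒ws int)))
        ... | no leaf = Records-agree r r′ (∈-filter⁺ (¬? ∘ internal?) (∈-allFin v) leaf)
        same-from : ∀ x → from c x ≡ from c′ x
        same-from x = trans (sym (from-to c′ _)) (cong (from c′) (trans (sym (same-to _)) (to-from c x)))

      many-leaves-bound : ∀ {Hs} → AllCopies T G Hs → AllPairs DifferentEdgeSets Hs →
        length Hs * 5 ^ length leaves ≤ n * suc D ^ length ws * (3 * suc D) ^ length leaves
      many-leaves-bound copies different = ≤-trans
        (*-monoˡ-≤ (5 ^ length leaves) (copies-bound Coded codes coded determined copies different)) codes-bound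

  -- Arithmetic of the exponents

  ^-exchange : ∀ a m k → (a ^ m) ^ k ≡ (a ^ k) ^ m
  ^-exchange a m k = trans (^-*-assoc a m k) (trans (cong (a ^_) (*-comm m k)) (sym (^-*-assoc a k m)))

  ^-linear-bound : ∀ e b → e * suc b ≤ 2 ^ b → ∀ {q} → b ≤′ q → e * suc q ≤ 2 ^ q
  ^-linear-bound e b base ≤′-refl = base
  ^-linear-bound e b base {suc q} (≤′-step b≤q) = begin
    e * suc (suc q)           ≤⟨ m≤m+n _ (e * q) ⟩
    e * suc (suc q) + e * q   ≡⟨ eq e q ⟩
    2 * (e * suc q)           ≤⟨ *-monoʳ-≤ 2 (^-linear-bound e b base b≤q) ⟩
    2 * 2 ^ q                 ∎
    where
    open ≤-Reasoning
    eq : ∀ a q → a * suc (suc q) + a * q ≡ 2 * (a * suc q)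
    eq = solve-∀

  -- With `q = n / e`, `n ≤ e * suc q ≤ 2 ^ q`; then take `e`-th powers. This absorbs the factor `n`
  -- from placing the first vertex.
  power≤exponential : ∀ e b .{{_ : NonZero e}} → e * suc b ≤ 2 ^ b → ∀ n → b * e ≤ n → n ^ e ≤ 2 ^ n
  power≤exponential e b base n be≤n = begin
    n ^ e                          ≤⟨ ^-monoˡ-≤ e n≤2^q ⟩
    (2 ^ (n / e)) ^ e              ≡⟨ ^-*-assoc 2 (n / e) e ⟩
    2 ^ (n / e * e)                ≤⟨ ^-monoʳ-≤ 2 (m/n*n≤m n e) ⟩
    2 ^ n                          ∎
    where
    open ≤-Reasoning
    n≤2^q : n ≤ 2 ^ (n / e)
    n≤2^q = begin
      n                        ≡⟨ m≡m%n+[m/n]*n n e ⟩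
      n % e + n / e * e        ≤⟨ +-monoˡ-≤ _ (<⇒≤ (m%n<n n e)) ⟩
      suc (n / e) * e          ≡⟨ *-comm (suc (n / e)) e ⟩
      e * suc (n / e)          ≤⟨ ^-linear-bound e b base (≤⇒≤′ (subst (_≤ n / e) (m*n/n≡m b e) (/-monoˡ-≤ e be≤n))) ⟩
      2 ^ (n / e)              ∎

  -- In the power `g * 100`, the bound `L * 100 ≤ n` turns the loss `100 ^ (L + L)` into
  -- `100 ^ (g + g)` per vertex, which leaves one numerical inequality.
  few-leaves-power : ∀ g {N L M n} → N * 5 ^ n ≤ 100 ^ (L + L) * (3 * M) ^ n → L * 100 ≤ n →
    6 * (100 ^ (g + g) * 3 ^ (g * 100)) ≤ 5 ^ (g * 100) →
    N ^ (g * 100) * 6 ^ n ≤ M ^ (g * 100 * n)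
  few-leaves-power g {N} {L} {M} {n} count L≤ saving =
    *-cancelʳ-≤ _ _ ((5 ^ n) ^ e) {{m^n≢0 (5 ^ n) e {{m^n≢0 5 n}}}} (begin
      N ^ e * 6 ^ n * (5 ^ n) ^ e
        ≡⟨ eq₁ (N ^ e) (6 ^ n) ((5 ^ n) ^ e) ⟩
      6 ^ n * (N ^ e * (5 ^ n) ^ e)
        ≡⟨ cong (6 ^ n *_) (^-distribʳ-* N (5 ^ n) e) ⟨
      6 ^ n * (N * 5 ^ n) ^ e
        ≤⟨ *-monoʳ-≤ (6 ^ n) (^-monoˡ-≤ e count) ⟩
      6 ^ n * (100 ^ (L + L) * (3 * M) ^ n) ^ e
        ≡⟨ cong (6 ^ n *_) (^-distribʳ-* (100 ^ (L + L)) _ e) ⟩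
      6 ^ n * ((100 ^ (L + L)) ^ e * ((3 * M) ^ n) ^ e)
        ≡⟨ cong (λ z → 6 ^ n * ((100 ^ (L + L)) ^ e * z)) (trans (^-exchange (3 * M) n e)
             (trans (cong (_^ n) (^-distribʳ-* 3 M e)) (^-distribʳ-* (3 ^ e) (M ^ e) n))) ⟩
      6 ^ n * ((100 ^ (L + L)) ^ e * ((3 ^ e) ^ n * (M ^ e) ^ n))
        ≤⟨ *-monoʳ-≤ (6 ^ n) (*-monoˡ-≤ _ hundreds) ⟩
      6 ^ n * ((100 ^ (g + g)) ^ n * ((3 ^ e) ^ n * (M ^ e) ^ n))
        ≡⟨ eq₂ (6 ^ n) ((100 ^ (g + g)) ^ n) ((3 ^ e) ^ n) ((M ^ e) ^ n) ⟩
      (M ^ e) ^ n * (6 ^ n * ((100 ^ (g + g)) ^ n * (3 ^ e) ^ n))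
        ≡⟨ cong ((M ^ e) ^ n *_) (trans (^-distribʳ-* 6 _ n) (cong (6 ^ n *_) (^-distribʳ-* (100 ^ (g + g)) (3 ^ e) n))) ⟨
      (M ^ e) ^ n * (6 * (100 ^ (g + g) * 3 ^ e)) ^ n
        ≤⟨ *-monoʳ-≤ ((M ^ e) ^ n) (^-monoˡ-≤ n saving) ⟩
      (M ^ e) ^ n * (5 ^ e) ^ n
        ≡⟨ cong₂ _*_ (^-*-assoc M e n) (^-exchange 5 e n) ⟩
      M ^ (e * n) * (5 ^ n) ^ e ∎)
    where
    open ≤-Reasoning
    e = g * 100
    eq₁ : ∀ a b c → a * b * c ≡ b * (a * c)
    eq₁ = solve-∀
    eq₂ : ∀ a b c d → a * (b * (c * d)) ≡ d * (a * (b * c))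
    eq₂ = solve-∀
    eq₃ : ∀ L g h → (L + L) * (g * h) ≡ (g + g) * (L * h)
    eq₃ = solve-∀
    hundreds : (100 ^ (L + L)) ^ e ≤ (100 ^ (g + g)) ^ n
    hundreds = begin
      (100 ^ (L + L)) ^ e           ≡⟨ ^-*-assoc 100 (L + L) e ⟩
      100 ^ ((L + L) * e)           ≡⟨ cong (100 ^_) (eq₃ L g 100) ⟩
      100 ^ ((g + g) * (L * 100))   ≤⟨ ^-monoʳ-≤ 100 (*-monoʳ-≤ (g + g) L≤) ⟩
      100 ^ ((g + g) * n)           ≡⟨ ^-*-assoc 100 (g + g) n ⟨
      (100 ^ (g + g)) ^ n           ∎

  -- The target costs 6 per vertex and `n ^ e` another 2. These 12 per vertex are at most `12 ^ 100`
  -- per leaf, where `5 ^ e` over `3 ^ e` is gained.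
  many-leaves-power : ∀ e {N L M n w} → N * 5 ^ L ≤ n * M ^ w * (3 * M) ^ L → w + L ≡ n → n ≤ L * 100 →
    n ^ e ≤ 2 ^ n → 12 ^ 100 * 3 ^ e ≤ 5 ^ e → N ^ e * 6 ^ n ≤ M ^ (e * n)
  many-leaves-power e {N} {L} {M} {n} {w} count w+L n≤ n^e≤ saving =
    *-cancelʳ-≤ _ _ ((5 ^ L) ^ e) {{m^n≢0 (5 ^ L) e {{m^n≢0 5 L}}}} (begin
      N ^ e * 6 ^ n * (5 ^ L) ^ e
        ≡⟨ eq₁ (N ^ e) (6 ^ n) ((5 ^ L) ^ e) ⟩
      6 ^ n * (N ^ e * (5 ^ L) ^ e)
        ≡⟨ cong (6 ^ n *_) (^-distribʳ-* N (5 ^ L) e) ⟨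
      6 ^ n * (N * 5 ^ L) ^ e
        ≤⟨ *-monoʳ-≤ (6 ^ n) (^-monoˡ-≤ e count) ⟩
      6 ^ n * (n * M ^ w * (3 * M) ^ L) ^ e
        ≡⟨ cong (λ z → 6 ^ n * z ^ e) regroup ⟩
      6 ^ n * (n * (M ^ n * 3 ^ L)) ^ e
        ≡⟨ cong (6 ^ n *_) (trans (^-distribʳ-* n _ e) (cong (n ^ e *_) (^-distribʳ-* (M ^ n) (3 ^ L) e))) ⟩
      6 ^ n * (n ^ e * ((M ^ n) ^ e * (3 ^ L) ^ e))
        ≤⟨ *-monoʳ-≤ (6 ^ n) (*-monoˡ-≤ _ n^e≤) ⟩
      6 ^ n * (2 ^ n * ((M ^ n) ^ e * (3 ^ L) ^ e))
        ≡⟨ eq₂ (6 ^ n) (2 ^ n) ((M ^ n) ^ e) ((3 ^ L) ^ e) ⟩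
      (M ^ n) ^ e * (6 ^ n * 2 ^ n * (3 ^ L) ^ e)
        ≤⟨ *-monoʳ-≤ ((M ^ n) ^ e) small ⟩
      (M ^ n) ^ e * (5 ^ L) ^ e
        ≡⟨ cong (_* (5 ^ L) ^ e) (trans (^-exchange M n e) (^-*-assoc M e n)) ⟩
      M ^ (e * n) * (5 ^ L) ^ e ∎)
    where
    open ≤-Reasoning
    eq₁ : ∀ a b c → a * b * c ≡ b * (a * c)
    eq₁ = solve-∀
    eq₂ : ∀ a b c d → a * (b * (c * d)) ≡ c * (a * b * d)
    eq₂ = solve-∀
    eq₃ : ∀ a b c d → a * b * (c * d) ≡ a * (b * d * c)
    eq₃ = solve-∀
    regroup : n * M ^ w * (3 * M) ^ L ≡ n * (M ^ n * 3 ^ L)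
    regroup = begin-equality
      n * M ^ w * (3 * M) ^ L        ≡⟨ cong (n * M ^ w *_) (^-distribʳ-* 3 M L) ⟩
      n * M ^ w * (3 ^ L * M ^ L)    ≡⟨ eq₃ n (M ^ w) (3 ^ L) (M ^ L) ⟩
      n * (M ^ w * M ^ L * 3 ^ L)    ≡⟨ cong (λ z → n * (z * 3 ^ L)) (trans (sym (^-distribˡ-+-* M w L)) (cong (M ^_) w+L)) ⟩
      n * (M ^ n * 3 ^ L)            ∎
    small : 6 ^ n * 2 ^ n * (3 ^ L) ^ e ≤ (5 ^ L) ^ e
    small = begin
      6 ^ n * 2 ^ n * (3 ^ L) ^ e       ≡⟨ cong₂ _*_ (sym (^-distribʳ-* 6 2 n)) (^-exchange 3 L e) ⟩
      12 ^ n * (3 ^ e) ^ L              ≤⟨ *-monoˡ-≤ _ (^-monoʳ-≤ 12 n≤) ⟩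
      12 ^ (L * 100) * (3 ^ e) ^ L      ≡⟨ cong (_* (3 ^ e) ^ L) (trans (cong (12 ^_) (*-comm L 100)) (sym (^-*-assoc 12 100 L))) ⟩
      (12 ^ 100) ^ L * (3 ^ e) ^ L      ≡⟨ ^-distribʳ-* (12 ^ 100) (3 ^ e) L ⟨
      (12 ^ 100 * 3 ^ e) ^ L            ≤⟨ ^-monoˡ-≤ L saving ⟩
      (5 ^ e) ^ L                       ≡⟨ ^-exchange 5 e L ⟩
      (5 ^ L) ^ e                       ∎

-- Transfer to the rationals and the bound on e

open Counting
import Data.Nat as ℕ
open import Data.Nat using (_!)
import Data.Nat.Properties as ℕ
open import Data.Integer as ℤ using (+_; +≤+)
import Data.Integer.Properties as ℤ
open import Data.Rational hiding (_≟_; NonZero)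
open import Data.Rational.Properties hiding (_≟_)
open import Data.Rational.Unnormalised as ℚᵘ using (mkℚᵘ; *≤*; *≡*)
import Data.Rational.Unnormalised.Properties as ℚᵘ
open import Algebra.Bundles using (CommutativeMonoid)
open import Algebra.Properties.CommutativeSemigroup (CommutativeMonoid.commutativeSemigroup *-1-commutativeMonoid)
  using (interchange)

toℚᵘ-ℕ→ℚ : ∀ a → toℚᵘ (ℕ→ℚ a) ℚᵘ.≃ mkℚᵘ (+ a) 0
toℚᵘ-ℕ→ℚ a = toℚᵘ-fromℚᵘ (mkℚᵘ (+ a) 0)

ℕ→ℚ-* : ∀ a b → ℕ→ℚ (a ℕ.* b) ≡ ℕ→ℚ a * ℕ→ℚ b
ℕ→ℚ-* a b = toℚᵘ-injective (ℚᵘ.≃-trans (toℚᵘ-ℕ→ℚ (a ℕ.* b)) (ℚᵘ.≃-sym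
  (ℚᵘ.≃-trans (toℚᵘ-homo-* (ℕ→ℚ a) (ℕ→ℚ b)) (ℚᵘ.≃-trans (ℚᵘ.*-cong (toℚᵘ-ℕ→ℚ a) (toℚᵘ-ℕ→ℚ b))
    (*≡* (cong (ℤ._* + 1) (sym (ℤ.pos-* a b))))))))

ℕ→ℚ-suc : ∀ a → ℕ→ℚ (suc a) ≡ 1ℚ + ℕ→ℚ a
ℕ→ℚ-suc a = toℚᵘ-injective (ℚᵘ.≃-trans (toℚᵘ-ℕ→ℚ (suc a)) (ℚᵘ.≃-sym
  (ℚᵘ.≃-trans (toℚᵘ-homo-+ 1ℚ (ℕ→ℚ a)) (ℚᵘ.≃-trans (ℚᵘ.+-cong (ℚᵘ.≃-refl {toℚᵘ 1ℚ}) (toℚᵘ-ℕ→ℚ a))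
    (*≡* (cong (λ z → (+ 1 ℤ.+ z) ℤ.* + 1) (ℤ.*-identityʳ (+ a))))))))

ℕ→ℚ-mono : ∀ {a b} → a ℕ.≤ b → ℕ→ℚ a ≤ ℕ→ℚ b
ℕ→ℚ-mono {a} {b} a≤b = toℚᵘ-cancel-≤ (ℚᵘ.≤-respˡ-≃ (ℚᵘ.≃-sym (toℚᵘ-ℕ→ℚ a)) (ℚᵘ.≤-respʳ-≃ (ℚᵘ.≃-sym (toℚᵘ-ℕ→ℚ b))
  (*≤* (ℤ.*-monoʳ-≤-nonNeg (+ 1) (+≤+ a≤b)))))

ℕ→ℚ-cancel-≤ : ∀ {a b} → ℕ→ℚ a ≤ ℕ→ℚ b → a ℕ.≤ b
ℕ→ℚ-cancel-≤ {a} {b} le with ℚᵘ.≤-respˡ-≃ (toℚᵘ-ℕ→ℚ a) (ℚᵘ.≤-respʳ-≃ (toℚᵘ-ℕ→ℚ b) (toℚᵘ-mono-≤ le))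
... | *≤* le′ = ℤ.drop‿+≤+ (ℤ.*-cancelʳ-≤-pos (+ a) (+ b) (+ 1) le′)

ℕ→ℚ-nonNeg : ∀ a → NonNegative (ℕ→ℚ a)
ℕ→ℚ-nonNeg a = normalize-nonNeg a 1

ℕ→ℚ-^ : ∀ a m → ℕ→ℚ (a ℕ.^ m) ≡ ℕ→ℚ a ^ℚ m
ℕ→ℚ-^ a zero    = refl
ℕ→ℚ-^ a (suc m) = trans (ℕ→ℚ-* a (a ℕ.^ m)) (cong (ℕ→ℚ a *_) (ℕ→ℚ-^ a m))

^ℚ-nonNeg : ∀ p .{{_ : NonNegative p}} m → NonNegative (p ^ℚ m)
^ℚ-nonNeg p zero    = nonNegative {1ℚ} (ℕ→ℚ-mono {0} {1} z≤n)
^ℚ-nonNeg p (suc m) = nonNeg*nonNeg⇒nonNeg p (p ^ℚ m) {{^ℚ-nonNeg p m}}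

*-mono-≤-nonNeg : ∀ {p q r s} → .{{_ : NonNegative p}} → .{{s≥0 : NonNegative s}} → p ≤ q → r ≤ s → p * r ≤ q * s
*-mono-≤-nonNeg {p} {q} {r} {s} p≤q r≤s = ≤-trans (*-monoˡ-≤-nonNeg p r≤s) (*-monoʳ-≤-nonNeg s p≤q)

^ℚ-monoˡ-≤ : ∀ {p q} .{{_ : NonNegative p}} m → p ≤ q → p ^ℚ m ≤ q ^ℚ m
^ℚ-monoˡ-≤ zero p≤q = ≤-refl
^ℚ-monoˡ-≤ {p} {q} (suc m) p≤q = *-mono-≤-nonNeg {{s≥0 = ^ℚ-nonNeg q {{nonNegative (≤-trans (nonNegative⁻¹ p) p≤q)}} m}}
  p≤q (^ℚ-monoˡ-≤ m p≤q)

^ℚ-distribʳ-* : ∀ p q m → (p * q) ^ℚ m ≡ p ^ℚ m * q ^ℚ m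
^ℚ-distribʳ-* p q zero    = refl
^ℚ-distribʳ-* p q (suc m) = trans (cong (p * q *_) (^ℚ-distribʳ-* p q m)) (interchange p q (p ^ℚ m) (q ^ℚ m))

1/-double : ∀ m n .{{_ : ℕ.NonZero m}} .{{_ : ℕ.NonZero n}} → 2 ℕ.* n ℕ.≤ m → + 1 / m + + 1 / m ≤ + 1 / n
1/-double m@(suc m-1) n@(suc n-1) 2n≤m = toℚᵘ-cancel-≤ (begin
  toℚᵘ (+ 1 / m + + 1 / m)                  ≃⟨ toℚᵘ-homo-+ (+ 1 / m) (+ 1 / m) ⟩
  toℚᵘ (+ 1 / m) ℚᵘ.+ toℚᵘ (+ 1 / m)        ≃⟨ ℚᵘ.+-cong (toℚᵘ-fromℚᵘ (mkℚᵘ (+ 1) m-1)) (toℚᵘ-fromℚᵘ (mkℚᵘ (+ 1) m-1)) ⟩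
  mkℚᵘ (+ 1) m-1 ℚᵘ.+ mkℚᵘ (+ 1) m-1        ≤⟨ *≤* (+≤+ (subst₂ ℕ._≤_ (eq₁ m n) (eq₂ m) (ℕ.*-monoˡ-≤ m 2n≤m))) ⟩
  mkℚᵘ (+ 1) n-1                            ≃⟨ toℚᵘ-fromℚᵘ (mkℚᵘ (+ 1) n-1) ⟨
  toℚᵘ (+ 1 / n)                            ∎)
  where
  open ℚᵘ.≤-Reasoning
  eq₁ : ∀ m n → 2 ℕ.* n ℕ.* m ≡ (1 ℕ.* m ℕ.+ 1 ℕ.* m) ℕ.* n
  eq₁ = solve-∀
  eq₂ : ∀ m → m ℕ.* m ≡ 1 ℕ.* (m ℕ.* m)
  eq₂ = solve-∀

inv! : ℕ → ℚ
inv! k = ((+ 1) / (k !)) {{k ℕ.!≢0}}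

-- The remaining factorial series after k terms is dominated by a geometric one of ratio 1/2.
ePartial+tail≤3 : ∀ k → ePartial (suc k) + (inv! (suc k) + inv! (suc k)) ≤ ℕ→ℚ 3
ePartial+tail≤3 zero    = toWitness {a? = _ ≤? _} tt
ePartial+tail≤3 (suc k) = begin
  ePartial (suc k) + inv! (suc k) + (inv! (suc (suc k)) + inv! (suc (suc k)))
    ≤⟨ +-monoʳ-≤ (ePartial (suc k) + inv! (suc k)) halved ⟩
  ePartial (suc k) + inv! (suc k) + inv! (suc k)
    ≡⟨ +-assoc (ePartial (suc k)) _ _ ⟩
  ePartial (suc k) + (inv! (suc k) + inv! (suc k))
    ≤⟨ ePartial+tail≤3 k ⟩
  ℕ→ℚ 3 ∎
  where
  open ≤-Reasoning
  halved : inv! (suc (suc k)) + inv! (suc (suc k)) ≤ inv! (suc k)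
  halved = 1/-double (suc (suc k) !) (suc k !) {{suc (suc k) ℕ.!≢0}} {{suc k ℕ.!≢0}}
    (ℕ.*-monoˡ-≤ (suc k !) (s≤s (s≤s (z≤n {k}))))

inv!-nonNeg : ∀ k → NonNegative (inv! k)
inv!-nonNeg k = normalize-nonNeg 1 (k !) {{k ℕ.!≢0}}

ePartial-nonNeg : ∀ k → NonNegative (ePartial k)
ePartial-nonNeg zero    = _
ePartial-nonNeg (suc k) = nonNeg+nonNeg⇒nonNeg (ePartial k) {{ePartial-nonNeg k}} (inv! k) {{inv!-nonNeg k}}

ePartial≤3 : ∀ k → ePartial k ≤ ℕ→ℚ 3
ePartial≤3 zero    = ℕ→ℚ-mono {0} {3} z≤n
ePartial≤3 (suc k) = ≤-trans (≤-trans (≤-reflexive (sym (+-identityʳ _)))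
  (+-monoʳ-≤ (ePartial (suc k)) (nonNegative⁻¹ (a + a)
    {{nonNeg+nonNeg⇒nonNeg a {{inv!-nonNeg (suc k)}} a {{inv!-nonNeg (suc k)}}}}))) (ePartial+tail≤3 k)
  where a = inv! (suc k)

power-transfer : ∀ e c c′ .{{_ : ℕ.NonZero c}} {N M n d E} .{{_ : NonNegative E}} → E ≤ ℕ→ℚ 3 →
  ℕ→ℚ c * ℕ→ℚ M ≤ ℕ→ℚ c′ * d → c′ ℕ.^ e ℕ.≤ 2 ℕ.* c ℕ.^ e → .{{_ : NonNegative d}} →
  N ℕ.^ e ℕ.* 6 ℕ.^ n ℕ.≤ M ℕ.^ (e ℕ.* n) →
  ℕ→ℚ N ^ℚ e * E ^ℚ n ≤ d ^ℚ (e ℕ.* n)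
power-transfer e c c′ {N} {M} {n} {d} {E} E≤3 cM≤ c′^e≤ count = *-cancelʳ-≤-pos (ℕ→ℚ k) {{k-pos}} (begin
  ℕ→ℚ N ^ℚ e * E ^ℚ n * ℕ→ℚ k
    ≤⟨ *-monoʳ-≤-nonNeg (ℕ→ℚ k) {{ℕ→ℚ-nonNeg k}}
         (*-monoˡ-≤-nonNeg (ℕ→ℚ N ^ℚ e) {{^ℚ-nonNeg (ℕ→ℚ N) {{ℕ→ℚ-nonNeg N}} e}} (^ℚ-monoˡ-≤ n E≤3)) ⟩
  ℕ→ℚ N ^ℚ e * ℕ→ℚ 3 ^ℚ n * ℕ→ℚ k
    ≡⟨ cong (_* ℕ→ℚ k) (cong₂ _*_ (sym (ℕ→ℚ-^ N e)) (sym (ℕ→ℚ-^ 3 n))) ⟩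
  ℕ→ℚ (N ℕ.^ e) * ℕ→ℚ (3 ℕ.^ n) * ℕ→ℚ k
    ≡⟨ trans (ℕ→ℚ-* (N ℕ.^ e ℕ.* 3 ℕ.^ n) k) (cong (_* ℕ→ℚ k) (ℕ→ℚ-* (N ℕ.^ e) (3 ℕ.^ n))) ⟨
  ℕ→ℚ (N ℕ.^ e ℕ.* 3 ℕ.^ n ℕ.* k)
    ≤⟨ ℕ→ℚ-mono naturals ⟩
  ℕ→ℚ ((c ℕ.* M) ℕ.^ m)
    ≡⟨ trans (ℕ→ℚ-^ (c ℕ.* M) m) (cong (_^ℚ m) (ℕ→ℚ-* c M)) ⟩
  (ℕ→ℚ c * ℕ→ℚ M) ^ℚ m
    ≤⟨ ^ℚ-monoˡ-≤ {{nonNeg*nonNeg⇒nonNeg (ℕ→ℚ c) {{ℕ→ℚ-nonNeg c}} (ℕ→ℚ M) {{ℕ→ℚ-nonNeg M}}}} m cM≤ ⟩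
  (ℕ→ℚ c′ * d) ^ℚ m
    ≡⟨ trans (^ℚ-distribʳ-* (ℕ→ℚ c′) d m) (cong (_* d ^ℚ m) (sym (ℕ→ℚ-^ c′ m))) ⟩
  ℕ→ℚ (c′ ℕ.^ m) * d ^ℚ m
    ≤⟨ *-monoʳ-≤-nonNeg (d ^ℚ m) {{^ℚ-nonNeg d m}} (ℕ→ℚ-mono c′^m≤) ⟩
  ℕ→ℚ k * d ^ℚ m
    ≡⟨ *-comm (ℕ→ℚ k) _ ⟩
  d ^ℚ m * ℕ→ℚ k ∎)
  where
  open ≤-Reasoning
  m = e ℕ.* n
  -- Multiplying by `k` avoids division: it turns `M` into `c * M`, completes 3 to 6, and dominates
  -- `c′ ^ m`.
  k = (2 ℕ.* c ℕ.^ e) ℕ.^ n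
  k-pos : Positive (ℕ→ℚ k)
  k-pos = normalize-pos k 1 {{_}} {{ℕ.m^n≢0 (2 ℕ.* c ℕ.^ e) n {{ℕ.m*n≢0 2 (c ℕ.^ e) {{_}} {{ℕ.m^n≢0 c e}}}}}}
  c′^m≤ : c′ ℕ.^ m ℕ.≤ k
  c′^m≤ = ℕ.≤-trans (ℕ.≤-reflexive (sym (ℕ.^-*-assoc c′ e n))) (ℕ.^-monoˡ-≤ n c′^e≤)
  eq : ∀ a b p q → a ℕ.* b ℕ.* (p ℕ.* q) ≡ a ℕ.* (b ℕ.* p) ℕ.* q
  eq = solve-∀
  naturals : N ℕ.^ e ℕ.* 3 ℕ.^ n ℕ.* k ℕ.≤ (c ℕ.* M) ℕ.^ m
  naturals = ℕ.≤-trans (ℕ.≤-reflexive (trans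
      (cong (N ℕ.^ e ℕ.* 3 ℕ.^ n ℕ.*_) (trans (^-distribʳ-* 2 (c ℕ.^ e) n) (cong (2 ℕ.^ n ℕ.*_) (ℕ.^-*-assoc c e n))))
      (trans (eq (N ℕ.^ e) (3 ℕ.^ n) (2 ℕ.^ n) (c ℕ.^ m)) (cong (λ z → N ℕ.^ e ℕ.* z ℕ.* c ℕ.^ m) (sym (^-distribʳ-* 3 2 n))))))
    (ℕ.≤-trans (ℕ.*-monoˡ-≤ (c ℕ.^ m) count)
      (ℕ.≤-reflexive (trans (ℕ.*-comm (M ℕ.^ m) _) (sym (^-distribʳ-* c M m)))))

-- Assembly of the two cases

-- 6 = 3 * 2, where 3 bounds e and 2 bounds the loss (10001 / 10000) ^ 1000 from replacing D + 1 by d.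
copies-power-bound : ∀ {n} (G T : Graph n) {D} → (∀ i → degree G i ℕ.≤ D) → 15000 ℕ.≤ n → IsTree T →
  ∀ {Hs} → AllCopies T G Hs → AllPairs DifferentEdgeSets Hs →
  length Hs ℕ.^ 1000 ℕ.* 6 ℕ.^ n ℕ.≤ suc D ℕ.^ (1000 ℕ.* n)
copies-power-bound {n} G T {D} deg≤ large (connected , acyclic) {Hs} copies different
  with build-all T (ℕ.≤-trans (ℕ.≤ᵇ⇒≤ 2 15000 tt) large) connected
... | vs , b , all∈ = by-leaves (ℕ.≤-total n (length leaves ℕ.* 100))
  where
  π = parent T b
  open Copies T G π (λ v → parent-adj T b (all∈ v)) deg≤
  open FewLeaves (λ {u} {v} → adj⇒parent T acyclic b (all∈ u) (all∈ v))
  open ManyLeaves (filter-ordered T internal? π b (λ _ → refl) (λ {x} _ → x , refl))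
    (filter⁺ internal? (build-unique T b)) (λ {v} → ∈-filter⁺ internal? (all∈ v))
    (λ v∈ → proj₂ (∈-filter⁻ internal? {xs = vs} v∈))
  by-leaves : n ℕ.≤ length leaves ℕ.* 100 ⊎ length leaves ℕ.* 100 ℕ.≤ n →
    length Hs ℕ.^ 1000 ℕ.* 6 ℕ.^ n ℕ.≤ suc D ℕ.^ (1000 ℕ.* n)
  by-leaves (inj₁ many) = many-leaves-power 1000 {length Hs} {length leaves} {suc D} {n} {length (filter internal? vs)}
    (many-leaves-bound copies different) internal+leaves many
    -- The threshold on `n` is `15 * 1000`, with `1000 * 16 ≤ 2 ^ 15`.
    (power≤exponential 1000 15 (ℕ.≤ᵇ⇒≤ _ _ tt) n large) (ℕ.≤ᵇ⇒≤ _ _ tt)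
  by-leaves (inj₂ few) = few-leaves-power 10 {length Hs} {length leaves} {suc D} {n}
    (few-leaves-bound copies different) few (ℕ.≤ᵇ⇒≤ _ _ tt)

max-degree : ∀ {n} (G : Graph (suc n)) → ∃[ i ] (∀ j → degree G j ℕ.≤ degree G i)
max-degree {n} G = argmax (degree G)
  where
  argmax : ∀ {m} (f : Fin (suc m) → ℕ) → ∃[ i ] (∀ j → f j ℕ.≤ f i)
  argmax {zero} f = zero , λ { zero → ℕ.≤-refl }
  argmax {suc m} f with argmax (λ i → f (suc i))
  ... | i , max with ℕ.≤-total (f zero) (f (suc i))
  ...   | inj₁ le = suc i , λ { zero → le ; (suc j) → max j }
  ...   | inj₂ ge = zero , λ { zero → ℕ.≤-refl ; (suc j) → ℕ.≤-trans (max j) ge }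

no-vertices : ∀ {Hs : List (Graph 0)} → AllPairs DifferentEdgeSets Hs → length Hs ℕ.≤ 1
no-vertices []                        = z≤n
no-vertices ([] ∷ [])                 = s≤s z≤n
no-vertices (((() , _) ∷ _) ∷ _)

-- The slack `c′ - c * p`, multiplied by `d`, has to cover the summand 1 scaled by `c`; it does so
-- at `d₀`, hence at every larger `d`.
scaled-suc-≤ : ∀ {c c′ p x d d₀} .{{_ : NonNegative c}} .{{_ : NonNegative (c′ - c * p)}} →
  c * 1ℚ ≤ (c′ - c * p) * d₀ → d₀ ≤ d → x ≤ p * d → c * (1ℚ + x) ≤ c′ * d
scaled-suc-≤ {c} {c′} {p} {x} {d} {d₀} slack d₀≤d x≤ = begin
  c * (1ℚ + x)                          ≤⟨ *-monoˡ-≤-nonNeg c (+-monoʳ-≤ 1ℚ x≤) ⟩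
  c * (1ℚ + p * d)                      ≡⟨ *-distribˡ-+ c 1ℚ (p * d) ⟩
  c * 1ℚ + c * (p * d)                  ≤⟨ +-monoˡ-≤ (c * (p * d)) (≤-trans slack (*-monoˡ-≤-nonNeg (c′ - c * p) d₀≤d)) ⟩
  (c′ - c * p) * d + c * (p * d)        ≡⟨ cong (λ z → (c′ - c * p) * d + z) (*-assoc c p d) ⟨
  (c′ - c * p) * d + c * p * d          ≡⟨ *-distribʳ-+ d (c′ - c * p) (c * p) ⟨
  (c′ - c * p + c * p) * d              ≡⟨ cong (_* d) (trans (+-assoc c′ (- (c * p)) (c * p))
                                             (trans (cong (λ z → c′ + z) (+-inverseˡ (c * p))) (+-identityʳ c′))) ⟩
  c′ * d                                ∎
  where open ≤-Reasoning

-- Large enough to force degrees of at least 15000, and to make the slack `10001 - 10000 * (1 + δ)`,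
-- nearly 1, times `d₀` exceed 10000.
d₀ : ℚ
d₀ = ℕ→ℚ 100000

module _ {d : ℚ} (d₀≤d : d₀ ≤ d) where

  d-nonNeg : NonNegative d
  d-nonNeg = nonNegative (≤-trans (toWitness {a? = 0ℚ ≤? d₀} tt) d₀≤d)

  -- A degree is at most the number of vertices, so this is how a large `d` forces `n` to be large.
  degree-large : ∀ {a} → (1ℚ - δ) * d ≤ ℕ→ℚ a → 15000 ℕ.≤ a
  degree-large {a} deg≥ = ℕ→ℚ-cancel-≤ (begin
    ℕ→ℚ 15000       ≤⟨ toWitness {a? = ℕ→ℚ 15000 ≤? (1ℚ - δ) * d₀} tt ⟩
    (1ℚ - δ) * d₀   ≤⟨ *-monoˡ-≤-nonNeg (1ℚ - δ) d₀≤d ⟩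
    (1ℚ - δ) * d    ≤⟨ deg≥ ⟩
    ℕ→ℚ a           ∎)
    where open ≤-Reasoning

  suc-degree-small : ∀ {a} → ℕ→ℚ a ≤ (1ℚ + δ) * d → ℕ→ℚ 10000 * ℕ→ℚ (suc a) ≤ ℕ→ℚ 10001 * d
  suc-degree-small {a} deg≤ = subst (λ x → ℕ→ℚ 10000 * x ≤ ℕ→ℚ 10001 * d) (sym (ℕ→ℚ-suc a))
    (scaled-suc-≤ {c = ℕ→ℚ 10000} {ℕ→ℚ 10001} {1ℚ + δ}
      (toWitness {a? = ℕ→ℚ 10000 * 1ℚ ≤? (ℕ→ℚ 10001 - ℕ→ℚ 10000 * (1ℚ + δ)) * d₀} tt) d₀≤d deg≤)

  copies-bound-nonempty : ∀ {n} (G T : Graph (suc n)) → AlmostRegular δ d G → IsTree T → NumCopiesAtMost T G (BelowBound (suc n) d)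
  copies-bound-nonempty {n} G T regular tree Hs copies different k =
    power-transfer 1000 10000 10001 {{_}} {length Hs} {suc (degree G i)} {suc n} {d} {ePartial k}
    {{ePartial-nonNeg k}} (ePartial≤3 k) (suc-degree-small {degree G i} (proj₂ (regular i))) (ℕ.≤ᵇ⇒≤ _ _ tt) {{d-nonNeg}}
    (copies-power-bound G T max large tree copies different)
    where
    i = proj₁ (max-degree G)
    max = proj₂ (max-degree G)
    large : 15000 ℕ.≤ suc n
    large = ℕ.≤-trans (degree-large {degree G i} (proj₁ (regular i)))
      (ℕ.≤-trans (hits≤length (adj G i) (allFin (suc n))) (ℕ.≤-reflexive (length-allFin (suc n))))

power-≤1 : ∀ e {N d E} → N ℕ.≤ 1 → ℕ→ℚ N ^ℚ e * E ^ℚ 0 ≤ d ^ℚ (e ℕ.* 0)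
power-≤1 e {N} {d} {E} N≤1 = begin
  ℕ→ℚ N ^ℚ e * 1ℚ       ≡⟨ *-identityʳ _ ⟩
  ℕ→ℚ N ^ℚ e            ≡⟨ ℕ→ℚ-^ N e ⟨
  ℕ→ℚ (N ℕ.^ e)         ≤⟨ ℕ→ℚ-mono (ℕ.^-monoˡ-≤ e N≤1) ⟩
  ℕ→ℚ (1 ℕ.^ e)         ≡⟨ cong ℕ→ℚ (ℕ.^-zeroˡ e) ⟩
  1ℚ                    ≡⟨ cong (d ^ℚ_) (ℕ.*-zeroʳ e) ⟨
  d ^ℚ (e ℕ.* 0)        ∎
  where open ≤-Reasoning

copies-bound-empty : ∀ {d} (G T : Graph 0) → NumCopiesAtMost T G (BelowBound 0 d)
copies-bound-empty {d} G T Hs copies different k = power-≤1 1000 {length Hs} {d} {ePartial k} (no-vertices different)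

theorem3p1 : Σ ℚ λ d₀ → (0ℚ < d₀) × (∀ (d : ℚ) → d₀ ≤ d → ∀ (n : ℕ) (G T : Graph n) → AlmostRegular δ d G → IsTree T → NumCopiesAtMost T G (BelowBound n d))
theorem3p1 = d₀ , toWitness {a? = 0ℚ <? d₀} tt , λ where
  -- Without vertices no degree forces `n` to be large, but different copies would have to differ at
  -- some pair of vertices, so there is at most one.
  d d₀≤d zero G T regular tree → copies-bound-empty {d} G T
  d d₀≤d (suc n) G T           → copies-bound-nonempty d₀≤d G T
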